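{- For every positive integer $n$, $$\sum_{r=0}^\infty(-1)^{T_r}\,a(n-T_r)=\begin{cases}(-1)^{T_{k-1}}\,T_{\lceil k/2\rceil}, & \text{if } n=T_{k+1}\text{ for some integer }k\ge1,\\ 0,&\text{otherwise.}\end{cases}$$
   Context: For a positive integer $n$, $a(n)$ is the signed number of partitions of $n$ into exactly two distinct part sizes, each occurring an odd number of times: $$a(n)=\sum (-1)^{r_1+r_2},$$ the sum being over all quadruples of integers $(x,y,r_1,r_2)$ with $1\le x<y$, $r_1,r_2\ge 0$ and $(2r_1+1)x+(2r_2+1)y=n$. By convention $a(m)=0$ for $m\le0$, so the sum in the claim is finite. $T_n=n(n+1)/2$ denotes the $n$-th triangular number. -}

module Defs where

open import Data.Nat as ℕ using (ℕ; suc; _≤_; _<_; s≤s)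
open import Data.Nat.Base using (>-nonZero)
import Data.Nat.DivMod as ℕ
import Data.Nat.Properties as ℕ
open import Data.Integer using (ℤ; +0; +[1+_]; -[1+_]; _+_; _^_; 0ℤ; -1ℤ)
open import Data.List using (List; map; foldr; filter; upTo; cartesianProduct)
open import Data.List.Membership.Propositional using (_∈_)
open import Data.List.Membership.Propositional.Properties using (∈-filter⁺; ∈-filter⁻; ∈-upTo⁺; ∈-cartesianProduct⁺)
open import Data.List.Relation.Unary.Unique.Propositional using (Unique)
import Data.List.Relation.Unary.Unique.Propositional.Properties as Unique
open import Data.Product using (_×_; _,_; ∃-syntax; proj₂)
open import Function.Bundles using (_⇔_; mk⇔)
open import Relation.Nullary.Decidable using (Dec; _×-dec_)
open import Relation.Binary.PropositionalEquality using (_≡_; refl)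

T : ℕ → ℕ
T n = n ℕ.* (n ℕ.+ 1) ℕ./ 2

∑ : List ℤ → ℤ
∑ = foldr _+_ 0ℤ

-- The value of ∑_{r≥0} f r for a series whose partial sums
-- f 0 + ⋯ + f (M - 1) are eventually constant.
HasSum : (ℕ → ℤ) → ℤ → Set
HasSum f s = ∃[ N ] (∀ M → N ≤ M → ∑ (map f (upTo M)) ≡ s)

Quadruple : Set
Quadruple = ℕ × ℕ × ℕ × ℕ

-- The partition of n with 2r₁+1 parts of size x and 2r₂+1 parts of size y.
Represents : ℕ → Quadruple → Set
Represents n (x , y , r₁ , r₂) =
  1 ≤ x × x < y × (2 ℕ.* r₁ ℕ.+ 1) ℕ.* x ℕ.+ (2 ℕ.* r₂ ℕ.+ 1) ℕ.* y ≡ n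

represents? : ∀ n q → Dec (Represents n q)
represents? n (x , y , r₁ , r₂) =
  (1 ℕ.≤? x) ×-dec (x ℕ.<? y) ×-dec (_ ℕ.≟ n)

box : ℕ → List Quadruple
box n = cartesianProduct I (cartesianProduct I (cartesianProduct I I))
  where I = upTo (suc n)

-- By ∈-quadruples and quadruples-unique below, this lists every quadruple
-- representing n exactly once: the bound n on the entries loses nothing.
quadruples : ℕ → List Quadruple
quadruples n = filter (represents? n) (box n)

sign : Quadruple → ℤ
sign (_ , _ , r₁ , r₂) = -1ℤ ^ (r₁ ℕ.+ r₂)

a : ℤ → ℤ
a +[1+ m ] = ∑ (map sign (quadruples (suc m)))
a +0       = 0ℤ
a -[1+ m ] = 0ℤ

private
  size≤ : ∀ r x → x ≤ (2 ℕ.* r ℕ.+ 1) ℕ.* x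
  size≤ r x rewrite ℕ.+-comm (2 ℕ.* r) 1 = ℕ.m≤m+n x _

  rep≤ : ∀ r x → 1 ≤ x → r ≤ (2 ℕ.* r ℕ.+ 1) ℕ.* x
  rep≤ r x 1≤x = ℕ.≤-trans
    (ℕ.≤-trans (ℕ.m≤m+n r _) (ℕ.m≤m+n (2 ℕ.* r) 1))
    (ℕ.m≤m*n (2 ℕ.* r ℕ.+ 1) x {{>-nonZero 1≤x}})

  ∈-box : ∀ n q → Represents n q → q ∈ box n
  ∈-box n (x , y , r₁ , r₂) (1≤x , x<y , refl) =
    ∈-cartesianProduct⁺ (left (size≤ r₁ x))
      (∈-cartesianProduct⁺ (right (size≤ r₂ y))
        (∈-cartesianProduct⁺ (left (rep≤ r₁ x 1≤x))
          (right (rep≤ r₂ y (ℕ.≤-trans 1≤x (ℕ.<⇒≤ x<y))))))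
    where
    left : ∀ {i} → i ≤ (2 ℕ.* r₁ ℕ.+ 1) ℕ.* x → i ∈ upTo (suc n)
    left p = ∈-upTo⁺ (s≤s (ℕ.≤-trans p (ℕ.m≤m+n _ _)))

    right : ∀ {i} → i ≤ (2 ℕ.* r₂ ℕ.+ 1) ℕ.* y → i ∈ upTo (suc n)
    right p = ∈-upTo⁺ (s≤s (ℕ.≤-trans p (ℕ.m≤n+m _ _)))

∈-quadruples : ∀ n q → q ∈ quadruples n ⇔ Represents n q
∈-quadruples n q = mk⇔
  (λ q∈ → proj₂ (∈-filter⁻ (represents? n) {xs = box n} q∈))
  (λ rep → ∈-filter⁺ (represents? n) (∈-box n q rep) rep)

quadruples-unique : ∀ n → Unique (quadruples n)
quadruples-unique n = Unique.filter⁺ (represents? n)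
  (Unique.cartesianProduct⁺ I! (Unique.cartesianProduct⁺ I! (Unique.cartesianProduct⁺ I! I!)))
  where I! = Unique.upTo⁺ (suc n)

{-# OPTIONS --safe #-}

-- With f x = qˣ / (1 + q²ˣ) = ∑ r, (-1)ʳ q⁽²ʳ⁺¹⁾ˣ, the generating function of a is the second
-- elementary symmetric function of f 1, f 2, …, i.e. the t²-coefficient of
-- ∏ₓ (1 + t qˣ + q²ˣ) / (1 + q²ˣ).  Putting t = z + z⁻¹, the Jacobi triple product gives
--   ∏ₓ (1 - qˣ) (1 + t qˣ + q²ˣ) = ∑ₖ q^(T k) pₖ(t),   pₖ(z + z⁻¹) = (zᵏ⁺¹ + z⁻ᵏ) / (z + 1),
-- and at t = 0 the right-hand side is ∑ₖ (-1)^(T k) q^(T k).  Dividing, the sum in question is the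
-- t²-coefficient of ∑ₖ q^(T k) pₖ(t).  The triple product is used in its finite form
--   ∏_{x ≤ N} (1 + t qˣ + q²ˣ) = ∑_{k ≤ N} q^(T k) [2N+1 choose N-k] pₖ(t),
-- which follows by induction on N from t pₖ = pₖ₋₁ + pₖ₊₁, and modulo qᴺ⁺¹ each Gaussian
-- coefficient cancels against ∏_{x ≤ N} (1 - qˣ).
module Submission where

open import Defs
open import Algebra.Bundles using (CommutativeRing)
open import Data.Bool using (true; false; if_then_else_; _∧_)
open import Data.Bool.Properties using (∧-zeroʳ; T-≡)
open import Data.Nat as ℕ using (ℕ; zero; suc; _≤_; _<_; _∸_; z≤n; s≤s; _<ᵇ_; _≡ᵇ_; ⌈_/2⌉)
import Data.Nat.DivMod as ℕ
import Data.Nat.Divisibility as ℕ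
import Data.Nat.Properties as ℕ
open import Data.Nat.Tactic.RingSolver using (solve-∀)
open import Data.Integer as ℤ using (ℤ; +_; 0ℤ; 1ℤ; -1ℤ)
import Data.Integer.Properties as ℤ
open import Data.Integer.Tactic.RingSolver using () renaming (solve-∀ to solveℤ-∀)
open import Data.List using ([]; _∷_; _++_; map; filter; upTo; cartesianProduct)
open import Data.List.Membership.Propositional using (_∈_)
open import Data.List.Membership.Propositional.Properties using (∈-filter⁺; ∈-filter⁻; ∈-upTo⁺; ∈-upTo⁻; ∈-cartesianProduct⁺; ∈-cartesianProduct⁻)
open import Data.List.Membership.Propositional.Properties.WithK using (unique∧set⇒bag)
open import Data.List.Properties using (map-++; map-cong; map-∘; upTo-∷ʳ)
open import Data.List.Relation.Binary.BagAndSetEquality using (∼bag⇒↭)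
open import Data.List.Relation.Binary.Permutation.Propositional using (_↭_; ↭⇒↭ₛ)
open import Data.List.Relation.Binary.Permutation.Propositional.Properties using (map⁺)
import Data.List.Relation.Binary.Permutation.Setoid.Properties as Permutation
open import Data.List.Relation.Unary.Unique.Propositional using (Unique)
import Data.List.Relation.Unary.Unique.Propositional.Properties as Unique
open import Data.Product using (_×_; _,_; proj₁; proj₂; ∃-syntax)
open import Function using (_∘_)
open import Function.Bundles using (Equivalence; mk⇔)
open import Level using (0ℓ)
open import Relation.Binary.Definitions using (tri<; tri≈; tri>)
open import Relation.Binary.PropositionalEquality as ≡ using (_≡_; _≢_)
open import Relation.Nullary using (¬_; does; yes; no; contradiction)
open import Relation.Nullary.Decidable using (dec-true; dec-false)
open import Relation.Unary using (Decidable)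

-- Triangular numbers.

T-suc : ∀ k → T (suc k) ≡ T k ℕ.+ suc k
T-suc k = begin
  suc k ℕ.* (suc k ℕ.+ 1) ℕ./ 2              ≡⟨ ≡.cong (ℕ._/ 2) (expand k) ⟩
  (k ℕ.* (k ℕ.+ 1) ℕ.+ suc k ℕ.* 2) ℕ./ 2    ≡⟨ ℕ.+-distrib-/-∣ʳ (k ℕ.* (k ℕ.+ 1)) (ℕ.n∣m*n (suc k)) ⟩
  T k ℕ.+ suc k ℕ.* 2 ℕ./ 2                  ≡⟨ ≡.cong (T k ℕ.+_) (ℕ.m*n/n≡m (suc k) 2) ⟩
  T k ℕ.+ suc k                              ∎
  where
  open ≡.≡-Reasoning
  expand : ∀ k → suc k ℕ.* (suc k ℕ.+ 1) ≡ k ℕ.* (k ℕ.+ 1) ℕ.+ suc k ℕ.* 2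
  expand = solve-∀

n≤T[n] : ∀ n → n ≤ T n
n≤T[n] zero    = z≤n
n≤T[n] (suc n) = ≡.subst (suc n ≤_) (≡.sym (T-suc n)) (ℕ.m≤n+m (suc n) (T n))

≥⇒<ᵇ≡false : ∀ {m n} → n ≤ m → (m <ᵇ n) ≡ false
≥⇒<ᵇ≡false z≤n       = ≡.refl
≥⇒<ᵇ≡false (s≤s n≤m) = ≥⇒<ᵇ≡false n≤m

-- Finite sums and polynomials in t over a commutative ring.

module FiniteTripleProduct {c ℓ} (R : CommutativeRing c ℓ) where

  open CommutativeRing R hiding (zero)
  open import Algebra.Properties.Semiring.Exp semiring public
    using (_^_; ^-homo-*; ^-congʳ)
  open import Algebra.Properties.Ring ring using (-‿distribʳ-*; -0#≈0#)
  open import Algebra.Solver.Ring.NaturalCoefficients.Default commutativeSemiring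
    using (solve; _:=_; _:+_; _:*_; con)
  open import Relation.Binary.Reasoning.Setoid setoid

  Σ< : ℕ → (ℕ → Carrier) → Carrier
  Σ< zero    f = 0#
  Σ< (suc n) f = Σ< n f + f n

  Σ<-cong : ∀ n {f g} → (∀ i → i < n → f i ≈ g i) → Σ< n f ≈ Σ< n g
  Σ<-cong zero    f≈g = refl
  Σ<-cong (suc n) f≈g =
    +-cong (Σ<-cong n λ i i<n → f≈g i (ℕ.m<n⇒m<1+n i<n)) (f≈g n (ℕ.n<1+n n))

  Σ<-zero : ∀ n {f} → (∀ i → i < n → f i ≈ 0#) → Σ< n f ≈ 0#
  Σ<-zero zero    f≈0 = refl
  Σ<-zero (suc n) f≈0 = trans
    (+-cong (Σ<-zero n λ i i<n → f≈0 i (ℕ.m<n⇒m<1+n i<n)) (f≈0 n (ℕ.n<1+n n)))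
    (+-identityˡ 0#)

  Σ<-+ : ∀ n f g → Σ< n (λ i → f i + g i) ≈ Σ< n f + Σ< n g
  Σ<-+ zero    f g = sym (+-identityˡ 0#)
  Σ<-+ (suc n) f g = trans (+-congʳ (Σ<-+ n f g))
    (solve 4 (λ α β c d → (α :+ β) :+ (c :+ d) := (α :+ c) :+ (β :+ d)) refl _ _ _ _)

  Σ<-*ˡ : ∀ n α f → Σ< n (λ i → α * f i) ≈ α * Σ< n f
  Σ<-*ˡ zero    α f = sym (zeroʳ α)
  Σ<-*ˡ (suc n) α f = trans (+-congʳ (Σ<-*ˡ n α f)) (sym (distribˡ α _ _))

  Σ<-*ʳ : ∀ n f α → Σ< n (λ i → f i * α) ≈ Σ< n f * α
  Σ<-*ʳ n f α = trans (Σ<-cong n (λ i _ → *-comm (f i) α)) (trans (Σ<-*ˡ n α f) (*-comm α _))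

  -- A family j ↦ g j stands for the polynomial ∑ g j · tʲ, and shift for multiplication by t.
  shift : (ℕ → Carrier) → ℕ → Carrier
  shift g zero    = 0#
  shift g (suc j) = g j

  one : ℕ → Carrier
  one zero    = 1#
  one (suc j) = 0#

  -- The boundary convention is g (-1) = g 0.
  neighbours : (ℕ → Carrier) → ℕ → Carrier
  neighbours g zero    = g 0 + g 1
  neighbours g (suc k) = g k + g (suc (suc k))

  -- Summation by parts. `neighbours` is the adjacency operator of a half-line with a loop at 0,
  -- hence symmetric: the convention at -1 contributes `c 0 * p 0` to both sides. Cutting the line
  -- after `m` leaves only the two terms across the edge from `m` to `suc m`.
  neighbours-adjoint : ∀ c p m →
    Σ< (suc m) (λ k → neighbours c k * p k) + c m * p (suc m) ≈
    Σ< (suc m) (λ k → c k * neighbours p k) + c (suc m) * p m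
  neighbours-adjoint c p zero =
    solve 4 (λ c₀ c₁ p₀ p₁ →
      (con 0 :+ (c₀ :+ c₁) :* p₀) :+ c₀ :* p₁ := (con 0 :+ c₀ :* (p₀ :+ p₁)) :+ c₁ :* p₀)
      refl (c 0) (c 1) (p 0) (p 1)
  neighbours-adjoint c p (suc m) = begin
    (S + (c₀ + c₂) * p₁) + c₁ * p₂        ≈⟨ solve 6 (λ s c₀ c₁ c₂ p₁ p₂ →
                                               (s :+ (c₀ :+ c₂) :* p₁) :+ c₁ :* p₂ :=
                                               (s :+ c₀ :* p₁) :+ (c₂ :* p₁ :+ c₁ :* p₂))
                                               refl S c₀ c₁ c₂ p₁ p₂ ⟩
    (S + c₀ * p₁) + (c₂ * p₁ + c₁ * p₂)   ≈⟨ +-congʳ (neighbours-adjoint c p m) ⟩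
    (S′ + c₁ * p₀) + (c₂ * p₁ + c₁ * p₂)  ≈⟨ solve 6 (λ s c₁ c₂ p₀ p₁ p₂ →
                                               (s :+ c₁ :* p₀) :+ (c₂ :* p₁ :+ c₁ :* p₂) :=
                                               (s :+ c₁ :* (p₀ :+ p₂)) :+ c₂ :* p₁)
                                               refl S′ c₁ c₂ p₀ p₁ p₂ ⟩
    (S′ + c₁ * (p₀ + p₂)) + c₂ * p₁       ∎
    where
    S  = Σ< (suc m) (λ k → neighbours c k * p k)
    S′ = Σ< (suc m) (λ k → c k * neighbours p k)
    c₀ = c m
    c₁ = c (suc m)
    c₂ = c (suc (suc m))
    p₀ = p m
    p₁ = p (suc m)
    p₂ = p (suc (suc m))

  -- Gaussian binomial coefficients.

  module _ (q : Carrier) where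

    -- G i j is the Gaussian binomial coefficient [i+j choose i].
    G : ℕ → ℕ → Carrier
    G zero    j       = 1#
    G (suc i) zero    = 1#
    G (suc i) (suc j) = G i (suc j) + q ^ suc i * G (suc i) j

    -- The mirror image of the Pascal rule that defines `G`. Both summands of the defining rule are
    -- expanded by the induction hypothesis and regrouped by the definition.
    G-pascal : ∀ i j → G (suc i) (suc j) ≈ q ^ suc j * G i (suc j) + G (suc i) j
    G-pascal zero zero = +-comm _ _
    G-pascal zero (suc j) = begin
      1# + q * 1# * G 1 (suc j)                     ≈⟨ +-congˡ (*-congˡ (G-pascal zero j)) ⟩
      1# + q * 1# * (q * q ^ j * 1# + G 1 j)        ≈⟨ solve 3 (λ q α g →
        con 1 :+ q :* con 1 :* (q :* α :* con 1 :+ g) :=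
        q :* (q :* α) :* con 1 :+ (con 1 :+ q :* con 1 :* g)) refl q (q ^ j) (G 1 j) ⟩
      q * (q * q ^ j) * 1# + (1# + q * 1# * G 1 j)  ∎
    G-pascal (suc i) zero = begin
      G (suc i) 1 + q * (q * q ^ i) * 1#            ≈⟨ +-congʳ (G-pascal i zero) ⟩
      (q * 1# * G i 1 + 1#) + q * (q * q ^ i) * 1#  ≈⟨ solve 3 (λ q α g →
        (q :* con 1 :* g :+ con 1) :+ q :* (q :* α) :* con 1 :=
        q :* con 1 :* (g :+ q :* α :* con 1) :+ con 1) refl q (q ^ i) (G i 1) ⟩
      q * 1# * (G i 1 + q * q ^ i * 1#) + 1#        ∎
    G-pascal (suc i) (suc j) = begin
      G (suc i) (2 ℕ.+ j) + α * G (2 ℕ.+ i) (suc j)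
        ≈⟨ +-cong (G-pascal i (suc j)) (*-congˡ (G-pascal (suc i) j)) ⟩
      (β * G i (2 ℕ.+ j) + G (suc i) (suc j)) +
        α * (q ^ suc j * G (suc i) (suc j) + G (2 ℕ.+ i) j)
        ≈⟨ solve 6 (λ q α β x y z →
             (q :* β :* x :+ y) :+ q :* α :* (β :* y :+ z) :=
             q :* β :* (x :+ α :* y) :+ (y :+ q :* α :* z))
             refl q (q ^ suc i) (q ^ suc j) (G i (2 ℕ.+ j)) (G (suc i) (suc j)) (G (2 ℕ.+ i) j) ⟩
      β * (G i (2 ℕ.+ j) + q ^ suc i * G (suc i) (suc j)) +
        (G (suc i) (suc j) + α * G (2 ℕ.+ i) j) ∎
      where
      α = q ^ (2 ℕ.+ i)
      β = q ^ (2 ℕ.+ j)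

    G-sym : ∀ i j → G i j ≈ G j i
    G-sym zero    zero    = refl
    G-sym zero    (suc j) = refl
    G-sym (suc i) zero    = refl
    G-sym (suc i) (suc j) = begin
      G i (suc j) + q ^ suc i * G (suc i) j  ≈⟨ +-cong (G-sym i (suc j)) (*-congˡ (G-sym (suc i) j)) ⟩
      G (suc j) i + q ^ suc i * G j (suc i)  ≈⟨ +-comm _ _ ⟩
      q ^ suc i * G j (suc i) + G (suc j) i  ≈⟨ G-pascal j i ⟨
      G (suc j) (suc i)                      ∎

    -- Equating the two Pascal rules for `G (suc i) (suc j)` gives x + αy = βx + y, and collecting
    -- terms avoids any division by q-factorials.
    G-ratio : ∀ i j → (1# - q ^ suc i) * G (suc i) j ≈ (1# - q ^ suc j) * G i (suc j)
    G-ratio i j = begin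
      (1# - α) * y                                ≈⟨ +-identityʳ _ ⟨
      (1# - α) * y + 0#                           ≈⟨ +-congˡ (trans (*-congʳ (-‿inverseʳ β)) (zeroˡ x)) ⟨
      (1# - α) * y + (β - β) * x                  ≈⟨ solve 6 (λ α α′ β β′ x y →
        (con 1 :+ α′) :* y :+ (β :+ β′) :* x := (β :* x :+ y) :+ (α′ :* y :+ β′ :* x))
        refl α (- α) β (- β) x y ⟩
      (β * x + y) + (- α * y + - β * x)           ≈⟨ +-congʳ (G-pascal i j) ⟨
      (x + α * y) + (- α * y + - β * x)           ≈⟨ solve 6 (λ α α′ β β′ x y →
        (x :+ α :* y) :+ (α′ :* y :+ β′ :* x) := (con 1 :+ β′) :* x :+ (α :+ α′) :* y)
        refl α (- α) β (- β) x y ⟩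
      (1# - β) * x + (α - α) * y                  ≈⟨ +-congˡ (trans (*-congʳ (-‿inverseʳ α)) (zeroˡ y)) ⟩
      (1# - β) * x + 0#                           ≈⟨ +-identityʳ _ ⟩
      (1# - β) * x                                ∎
      where
      α = q ^ suc i
      β = q ^ suc j
      x = G i (suc j)
      y = G (suc i) j

    -- The lower index is reduced by one, with value 0 at lower index -1, so that the recurrences
    -- below extend to the boundary.
    G⁻ : ℕ → ℕ → Carrier
    G⁻ zero    j = 0#
    G⁻ (suc i) j = G i j

    -- Two Pascal steps lower the upper index i + j + 3 by two, just as passing from N + 1 to N
    -- lowers 2N + 3 to 2N + 1. Up to powers of q this is the recurrence defining `C`.
    G-pascal² : ∀ i j → G (suc i) (2 ℕ.+ j) ≈
      (1# + q ^ suc i * q ^ suc j) * G i (suc j) +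
      (q ^ suc i * G (suc i) j + q ^ (2 ℕ.+ j) * G⁻ i (2 ℕ.+ j))
    G-pascal² i j = begin
      G i (2 ℕ.+ j) + α * G (suc i) (suc j)
        ≈⟨ +-cong (lower i) (*-congˡ (G-pascal i j)) ⟩
      (G i (suc j) + q ^ (2 ℕ.+ j) * G⁻ i (2 ℕ.+ j)) + α * (β * G i (suc j) + G (suc i) j)
        ≈⟨ solve 5 (λ α β x y z →
             (x :+ z) :+ α :* (β :* x :+ y) :=
             (con 1 :+ α :* β) :* x :+ (α :* y :+ z))
             refl α β (G i (suc j)) (G (suc i) j) (q ^ (2 ℕ.+ j) * G⁻ i (2 ℕ.+ j)) ⟩
      (1# + α * β) * G i (suc j) + (α * G (suc i) j + q ^ (2 ℕ.+ j) * G⁻ i (2 ℕ.+ j)) ∎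
      where
      α = q ^ suc i
      β = q ^ suc j
      lower : ∀ i → G i (2 ℕ.+ j) ≈ G i (suc j) + q ^ (2 ℕ.+ j) * G⁻ i (2 ℕ.+ j)
      lower zero    = sym (trans (+-congˡ (zeroʳ _)) (+-identityʳ 1#))
      lower (suc i) = trans (G-pascal i (suc j)) (+-comm _ _)

    -- Coefficients of the finite triple product.

    -- C N k is the coefficient of pₖ in ∏_{x ≤ N} (1 + t qˣ + q²ˣ).
    C : ℕ → ℕ → Carrier
    C zero    = one
    C (suc N) k = (1# + q ^ suc N * q ^ suc N) * C N k + q ^ suc N * neighbours (C N) k

    -- Each factor of the product moves the index `k` by at most one, starting from the single index
    -- 0.
    C-vanishes : ∀ N k → N < k → C N k ≈ 0#
    C-vanishes zero    (suc k) _         = refl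
    C-vanishes (suc N) (suc k) (s≤s N<k) = begin
      u * C N (suc k) + v * (C N k + C N (2 ℕ.+ k))  ≈⟨ +-cong (*-congˡ (C-vanishes N (suc k) (ℕ.m<n⇒m<1+n N<k)))
                                                          (*-congˡ (+-cong (C-vanishes N k N<k)
                                                            (C-vanishes N (2 ℕ.+ k) (ℕ.m<n⇒m<1+n (ℕ.m<n⇒m<1+n N<k))))) ⟩
      u * 0# + v * (0# + 0#)                         ≈⟨ solve 2 (λ u v → u :* con 0 :+ v :* (con 0 :+ con 0) := con 0) refl u v ⟩
      0#                                             ∎
      where
      u = 1# + q ^ suc N * q ^ suc N
      v = q ^ suc N

    q^-split : ∀ {m} i j → m ≡ i ℕ.+ j → q ^ m ≈ q ^ i * q ^ j
    q^-split i j m≡i+j = trans (^-congʳ q m≡i+j) (^-homo-* q i j)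

    -- The shifted index i = N + 1 − k covers k = N + 1, where both sides vanish.
    C-closed : ∀ N i k → i ℕ.+ k ≡ suc N → C N k ≈ q ^ T k * G⁻ i (i ℕ.+ (k ℕ.+ k))
    C-closed zero zero          _    ≡.refl = sym (zeroʳ _)
    C-closed zero (suc zero)    zero _      = sym (*-identityˡ 1#)
    C-closed (suc N) zero       _    ≡.refl = trans (C-vanishes (suc N) _ ℕ.≤-refl) (sym (zeroʳ _))
    C-closed (suc N) (suc zero) _    ≡.refl = begin
      u * C N (suc N) + q ^ suc N * (C N N + C N (2 ℕ.+ N))
        ≈⟨ +-cong (*-congˡ (C-vanishes N (suc N) ℕ.≤-refl))
                  (*-congˡ (+-cong (C-closed N 1 N ≡.refl) (C-vanishes N (2 ℕ.+ N) (ℕ.m≤n⇒m≤1+n ℕ.≤-refl)))) ⟩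
      u * 0# + q ^ suc N * (q ^ T N * 1# + 0#)
        ≈⟨ solve 3 (λ u v w → u :* con 0 :+ v :* (w :* con 1 :+ con 0) := w :* v :* con 1) refl u _ _ ⟩
      (q ^ T N * q ^ suc N) * 1#
        ≈⟨ *-congʳ (q^-split (T N) (suc N) (T-suc N)) ⟨
      q ^ T (suc N) * 1# ∎
      where u = 1# + q ^ suc N * q ^ suc N
    -- At `k = 0` the neighbour at -1 is `C i 0` itself. Symmetry of the Gaussian coefficient turns
    -- it into the `G (suc i) i` that `G-pascal²` asks for.
    C-closed (suc N) (suc (suc i)) zero eq
      with ≡.refl ← ≡.trans (≡.sym (ℕ.+-identityʳ (suc i))) (ℕ.suc-injective eq)
      rewrite ℕ.+-identityʳ i = begin
      (1# + α * α) * C i 0 + α * (C i 0 + C i 1)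
        ≈⟨ +-cong (*-congˡ C₀) (*-congˡ (+-cong (trans C₀ (*-congˡ (G-sym i (suc i)))) C₁)) ⟩
      (1# + α * α) * (1# * G i (suc i)) + α * (1# * G (suc i) i + q * 1# * G⁻ i (2 ℕ.+ i))
        ≈⟨ solve 5 (λ q α x y z →
             (con 1 :+ α :* α) :* (con 1 :* x) :+ α :* (con 1 :* y :+ q :* con 1 :* z) :=
             con 1 :* ((con 1 :+ α :* α) :* x :+ (α :* y :+ q :* α :* z)))
             refl q α (G i (suc i)) (G (suc i) i) (G⁻ i (2 ℕ.+ i)) ⟩
      1# * ((1# + α * α) * G i (suc i) + (α * G (suc i) i + q * α * G⁻ i (2 ℕ.+ i)))
        ≈⟨ *-congˡ (G-pascal² i i) ⟨
      1# * G (suc i) (2 ℕ.+ i) ∎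
      where
      α = q ^ suc i
      C₀ : C i 0 ≈ 1# * G i (suc i)
      C₀ = ≡.subst (λ m → C i 0 ≈ 1# * G i (suc m)) (ℕ.+-identityʳ i)
             (C-closed i (suc i) 0 (ℕ.+-identityʳ (suc i)))
      C₁ : C i 1 ≈ q * 1# * G⁻ i (2 ℕ.+ i)
      C₁ = ≡.subst (λ m → C i 1 ≈ q * 1# * G⁻ i m) (ℕ.+-comm i 2)
             (C-closed i i 1 (ℕ.+-comm i 1))
    -- Every power of q is written through α, β and w: q^(N+1) = αβ, q^(j+1) = αβ², q^T(k+1) = wβ.
    -- What remains is `G-pascal²` multiplied by wβ.
    C-closed (suc N) (suc (suc i)) (suc k) eq = begin
      (1# + q ^ suc N * q ^ suc N) * C N (suc k) + q ^ suc N * (C N k + C N (2 ℕ.+ k))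
        ≈⟨ +-cong (*-cong (+-congˡ (*-cong Q≈ Q≈)) (trans (C-closed N (suc i) (suc k) (≡.sym N≡)) (*-congʳ T₁≈)))
                  (*-cong Q≈ (+-cong C₀ C₂)) ⟩
      (1# + α * β * (α * β)) * (w * β * G i (suc j)) +
        α * β * (w * G (suc i) j + w * β * (q * β) * G⁻ i (2 ℕ.+ j))
        ≈⟨ solve 7 (λ q α β w x y z →
             (con 1 :+ α :* β :* (α :* β)) :* (w :* β :* x) :+
               α :* β :* (w :* y :+ w :* β :* (q :* β) :* z) :=
             w :* β :* ((con 1 :+ α :* (α :* (β :* β))) :* x :+ (α :* y :+ q :* (α :* (β :* β)) :* z)))
             refl q α β w (G i (suc j)) (G (suc i) j) (G⁻ i (2 ℕ.+ j)) ⟩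
      w * β * ((1# + α * (α * (β * β))) * G i (suc j) +
        (α * G (suc i) j + q * (α * (β * β)) * G⁻ i (2 ℕ.+ j)))
        ≈⟨ *-cong T₁≈ (+-cong (*-congʳ (+-congˡ (*-congˡ j≈))) (+-congˡ (*-congʳ (*-congˡ j≈)))) ⟨
      q ^ T (suc k) * ((1# + α * q ^ suc j) * G i (suc j) +
        (α * G (suc i) j + q ^ (2 ℕ.+ j) * G⁻ i (2 ℕ.+ j)))
        ≈⟨ *-congˡ (G-pascal² i j) ⟨
      q ^ T (suc k) * G (suc i) (2 ℕ.+ j) ∎
      where
      N≡ : suc N ≡ suc i ℕ.+ suc k
      N≡ = ≡.sym (ℕ.suc-injective eq)
      j = i ℕ.+ (suc k ℕ.+ suc k)
      α = q ^ suc i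
      β = q ^ suc k
      w = q ^ T k
      Q≈ : q ^ suc N ≈ α * β
      Q≈ = q^-split (suc i) (suc k) N≡
      j≈ : q ^ suc j ≈ α * (β * β)
      j≈ = trans (q^-split (suc i) (suc k ℕ.+ suc k) ≡.refl) (*-congˡ (q^-split (suc k) (suc k) ≡.refl))
      T₁≈ : q ^ T (suc k) ≈ w * β
      T₁≈ = q^-split (T k) (suc k) (T-suc k)
      C₀ : C N k ≈ w * G (suc i) j
      C₀ = ≡.subst (λ m → C N k ≈ w * G (suc i) m) (index i k)
             (C-closed N (2 ℕ.+ i) k (≡.trans (≡.cong suc (≡.sym (ℕ.+-suc i k))) (≡.sym N≡)))
        where
        index : ∀ i k → 2 ℕ.+ i ℕ.+ (k ℕ.+ k) ≡ i ℕ.+ (suc k ℕ.+ suc k)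
        index = solve-∀
      C₂ : C N (2 ℕ.+ k) ≈ w * β * (q * β) * G⁻ i (2 ℕ.+ j)
      C₂ = trans
             (≡.subst (λ m → C N (2 ℕ.+ k) ≈ q ^ T (2 ℕ.+ k) * G⁻ i m) (index i k)
               (C-closed N i (2 ℕ.+ k) (≡.trans (ℕ.+-suc i (suc k)) (≡.sym N≡))))
             (*-congʳ (trans (q^-split (T (suc k)) (2 ℕ.+ k) (T-suc (suc k))) (*-congʳ T₁≈)))
        where
        index : ∀ i k → i ℕ.+ (2 ℕ.+ k ℕ.+ (2 ℕ.+ k)) ≡ 2 ℕ.+ (i ℕ.+ (suc k ℕ.+ suc k))
        index = solve-∀

    -- F N j is the coefficient of tʲ in ∏_{x ≤ N} (1 + t qˣ + q²ˣ).
    F : ℕ → ℕ → Carrier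
    F zero    = one
    F (suc N) j = (1# + q ^ suc N * q ^ suc N) * F N j + q ^ suc N * shift (F N) j

    module _ (p : ℕ → ℕ → Carrier)
             (p-zero : ∀ j → p 0 j ≈ one j)
             (p-neighbours : ∀ k j → neighbours (λ k → p k j) k ≈ shift (p k) j) where

      -- Multiplication by t acts on the family p as `neighbours`, and `neighbours-adjoint` moves
      -- that operator between p and the coefficients `C N`. The bound `M` is any number above `N`,
      -- so the induction uses one range for two consecutive products, and both boundary terms carry
      -- a vanishing value of `C N`.
      F-expansion : ∀ N M j → N < M → F N j ≈ Σ< M (λ k → C N k * p k j)
      F-expansion zero (suc zero) j _ = begin
        one j               ≈⟨ p-zero j ⟨
        p 0 j               ≈⟨ solve 1 (λ x → x := con 0 :+ con 1 :* x) refl (p 0 j) ⟩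
        0# + 1# * p 0 j     ∎
      F-expansion zero (suc (suc M)) j _ = begin
        one j                               ≈⟨ F-expansion zero (suc M) j (s≤s z≤n) ⟩
        S                                   ≈⟨ solve 2 (λ s x → s := s :+ con 0 :* x) refl S (p (suc M) j) ⟩
        S + 0# * p (suc M) j                ∎
        where S = Σ< (suc M) (λ k → C zero k * p k j)
      F-expansion (suc N) (suc M) j (s≤s N<M) = sym (begin
        Σ< (suc M) (λ k → (u * C N k + v * neighbours (C N) k) * p k j)
          ≈⟨ Σ<-cong (suc M) (λ k _ → solve 5 (λ u v x y z →
               (u :* x :+ v :* y) :* z := u :* (x :* z) :+ v :* (y :* z))
               refl u v (C N k) (neighbours (C N) k) (p k j)) ⟩
        Σ< (suc M) (λ k → u * (C N k * p k j) + v * (neighbours (C N) k * p k j))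
          ≈⟨ trans (Σ<-+ (suc M) _ _) (+-cong (Σ<-*ˡ (suc M) u _) (Σ<-*ˡ (suc M) v _)) ⟩
        u * Σ< (suc M) (λ k → C N k * p k j) + v * Σ< (suc M) (λ k → neighbours (C N) k * p k j)
          ≈⟨ +-cong (*-congˡ (sym (F-expansion N (suc M) j (ℕ.m<n⇒m<1+n N<M)))) (*-congˡ moved) ⟩
        u * F N j + v * shift (F N) j ∎)
        where
        u = 1# + q ^ suc N * q ^ suc N
        v = q ^ suc N
        pⱼ = λ k → p k j
        drop : ∀ {x} y z → x ≈ 0# → y + x * z ≈ y
        drop y z x≈0 = trans (+-congˡ (trans (*-congʳ x≈0) (zeroˡ z))) (+-identityʳ y)
        shifted : ∀ j → Σ< (suc M) (λ k → C N k * shift (p k) j) ≈ shift (F N) j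
        shifted zero    = Σ<-zero (suc M) (λ k _ → zeroʳ (C N k))
        shifted (suc j) = sym (F-expansion N (suc M) j (ℕ.m<n⇒m<1+n N<M))
        moved : Σ< (suc M) (λ k → neighbours (C N) k * p k j) ≈ shift (F N) j
        moved = begin
          Σ< (suc M) (λ k → neighbours (C N) k * p k j)
            ≈⟨ drop _ (p (suc M) j) (C-vanishes N M N<M) ⟨
          Σ< (suc M) (λ k → neighbours (C N) k * p k j) + C N M * p (suc M) j
            ≈⟨ neighbours-adjoint (C N) pⱼ M ⟩
          Σ< (suc M) (λ k → C N k * neighbours pⱼ k) + C N (suc M) * p M j
            ≈⟨ drop _ (p M j) (C-vanishes N (suc M) (ℕ.m<n⇒m<1+n N<M)) ⟩
          Σ< (suc M) (λ k → C N k * neighbours pⱼ k)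
            ≈⟨ Σ<-cong (suc M) (λ k _ → *-congˡ (p-neighbours k j)) ⟩
          Σ< (suc M) (λ k → C N k * shift (p k) j)
            ≈⟨ shifted j ⟩
          shift (F N) j ∎

    -- Cancellation against the Euler product in a truncated ring.

    Φ : ℕ → Carrier
    Φ zero    = 1#
    Φ (suc i) = Φ i * (1# - q ^ suc i)

    -- How truncation discards factors 1 - qᵐ: `s` and `x` will be powers of q whose product lies
    -- beyond the truncation order.
    absorb : ∀ {s x} z → s * x ≈ 0# → s * (z * (1# - x)) ≈ s * z
    absorb {s} {x} z sx≈0 = begin
      s * (z * (1# - x))      ≈⟨ solve 3 (λ s z x → s :* (z :* (con 1 :+ x)) := s :* z :+ z :* (s :* x)) refl s z (- x) ⟩
      s * z + z * (s * - x)   ≈⟨ +-congˡ (*-congˡ (sym (-‿distribʳ-* s x))) ⟩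
      s * z + z * - (s * x)   ≈⟨ +-congˡ (*-congˡ (trans (-‿cong sx≈0) -0#≈0#)) ⟩
      s * z + z * 0#          ≈⟨ solve 2 (λ x z → x :+ z :* con 0 := x) refl (s * z) z ⟩
      s * z                   ∎

    -- This is (q;q)ᵢ [i+j choose i] ≡ 1 (mod qʲ⁺¹), multiplied by a power qˢ with qˢ⁺ʲ⁺¹ = 0.
    Φ-G : ∀ s i j → (∀ m → s ℕ.+ j < m → q ^ m ≈ 0#) → q ^ s * (Φ i * G i j) ≈ q ^ s
    Φ-G s zero    j q^≈0 = trans (*-congˡ (*-identityˡ 1#)) (*-identityʳ (q ^ s))
    Φ-G s (suc i) j q^≈0 = begin
      q ^ s * (Φ i * (1# - q ^ suc i) * G (suc i) j)
        -- `G-ratio` trades the last factor of `Φ (suc i)` for 1 - q^(j+1), whose degree is high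
        -- enough to be absorbed.
        ≈⟨ *-congˡ (trans (*-assoc _ _ _) (*-congˡ (G-ratio i j))) ⟩
      q ^ s * (Φ i * ((1# - q ^ suc j) * G i (suc j)))
        ≈⟨ solve 4 (λ s f y g → s :* (f :* (y :* g)) := s :* (f :* g :* y))
             refl (q ^ s) (Φ i) (1# - q ^ suc j) (G i (suc j)) ⟩
      q ^ s * (Φ i * G i (suc j) * (1# - q ^ suc j))
        ≈⟨ absorb _ (trans (sym (^-homo-* q s (suc j))) (q^≈0 _ (ℕ.≤-reflexive (≡.sym (ℕ.+-suc s j))))) ⟩
      q ^ s * (Φ i * G i (suc j))
        ≈⟨ Φ-G s i (suc j) (λ m s+1+j<m → q^≈0 m (ℕ.<⇒≤ (≡.subst (_< m) (ℕ.+-suc s j) s+1+j<m))) ⟩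
      q ^ s ∎

    Φ-extend : ∀ s i d → (∀ m → s ℕ.+ i < m → q ^ m ≈ 0#) → q ^ s * Φ (d ℕ.+ i) ≈ q ^ s * Φ i
    Φ-extend s i zero    q^≈0 = refl
    Φ-extend s i (suc d) q^≈0 = trans
      (absorb _ (trans (sym (^-homo-* q s (suc (d ℕ.+ i))))
        (q^≈0 _ (ℕ.≤-trans (ℕ.≤-reflexive (≡.sym (ℕ.+-suc s i))) (ℕ.+-monoʳ-≤ s (s≤s (ℕ.m≤n+m i d)))))))
      (Φ-extend s i d q^≈0)

    module _ (N : ℕ) (q^≈0 : ∀ m → N < m → q ^ m ≈ 0#) where

      -- By `C-closed` the power q^(T k) stands in front. Since k ≤ T k, it has T k + (N - k) ≥ N,
      -- so it absorbs the factors of `Φ N` beyond N - k. The remaining `Φ (N ∸ k)` cancels the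
      -- Gaussian coefficient by `Φ-G`.
      Φ-C : ∀ k → k ≤ N → Φ N * C N k ≈ q ^ T k
      Φ-C k k≤N = begin
        Φ N * C N k
          ≈⟨ *-congˡ (C-closed N (suc i) k (≡.cong suc (ℕ.m∸n+n≡m k≤N))) ⟩
        Φ N * (q ^ T k * G i j)
          ≈⟨ solve 3 (λ f s g → f :* (s :* g) := s :* f :* g) refl (Φ N) (q ^ T k) (G i j) ⟩
        q ^ T k * Φ N * G i j
          ≈⟨ *-congʳ (*-congˡ (reflexive (≡.cong Φ (≡.sym (ℕ.m+[n∸m]≡n k≤N))))) ⟩
        q ^ T k * Φ (k ℕ.+ i) * G i j
          ≈⟨ *-congʳ (Φ-extend (T k) i k (λ m Tk+i<m → q^≈0 m (ℕ.≤-<-trans N≤Tk+i Tk+i<m))) ⟩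
        q ^ T k * Φ i * G i j
          ≈⟨ *-assoc _ _ _ ⟩
        q ^ T k * (Φ i * G i j)
          ≈⟨ Φ-G (T k) i j (λ m Tk+j<m → q^≈0 m (ℕ.≤-<-trans
               (ℕ.≤-trans N≤Tk+i (ℕ.+-monoʳ-≤ (T k) (ℕ.m≤n⇒m≤1+n (ℕ.m≤m+n i (k ℕ.+ k))))) Tk+j<m)) ⟩
        q ^ T k ∎
        where
        i = N ℕ.∸ k
        j = suc i ℕ.+ (k ℕ.+ k)
        N≤Tk+i : N ≤ T k ℕ.+ i
        N≤Tk+i = ≡.subst (_≤ T k ℕ.+ i) (ℕ.m+[n∸m]≡n k≤N) (ℕ.+-monoˡ-≤ i (n≤T[n] k))

    -- Geometric series and elementary symmetric functions.

    A : ℕ → Carrier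
    A zero    = 1#
    A (suc N) = (1# + q ^ suc N * q ^ suc N) * A N

    -- A finite geometric series of ratio -q²ˣ telescopes against 1 + q²ˣ; the second summand is the
    -- remainder.
    geometric : ∀ x n →
      (1# + q ^ x * q ^ x) * Σ< n (λ r → (- 1#) ^ r * q ^ ((2 ℕ.* r ℕ.+ 1) ℕ.* x)) +
      (- 1#) ^ n * q ^ ((2 ℕ.* n ℕ.+ 1) ℕ.* x) ≈ q ^ x
    geometric x zero = begin
      (1# + q ^ x * q ^ x) * 0# + 1# * q ^ (x ℕ.+ 0)  ≈⟨ solve 2 (λ u v → u :* con 0 :+ con 1 :* v := v) refl _ _ ⟩
      q ^ (x ℕ.+ 0)                                   ≈⟨ ^-congʳ q (ℕ.+-identityʳ x) ⟩
      q ^ x                                           ∎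
    geometric x (suc n) = begin
      (1# + y * y) * (S + ε * w) + - 1# * ε * q ^ ((2 ℕ.* suc n ℕ.+ 1) ℕ.* x)
        ≈⟨ +-congˡ (*-congˡ (trans (q^-split e (x ℕ.+ x) (next n x)) (*-congˡ (q^-split x x ≡.refl)))) ⟩
      (1# + y * y) * (S + ε * w) + - 1# * ε * (w * (y * y))
        ≈⟨ solve 5 (λ y s ε w m →
             (con 1 :+ y :* y) :* (s :+ ε :* w) :+ m :* ε :* (w :* (y :* y)) :=
             ((con 1 :+ y :* y) :* s :+ ε :* w) :+ (con 1 :+ m) :* (ε :* (w :* (y :* y))))
             refl y S ε w (- 1#) ⟩
      ((1# + y * y) * S + ε * w) + (1# - 1#) * (ε * (w * (y * y)))
        ≈⟨ +-cong (geometric x n) (trans (*-congʳ (-‿inverseʳ 1#)) (zeroˡ _)) ⟩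
      y + 0#
        ≈⟨ +-identityʳ y ⟩
      y ∎
      where
      e = (2 ℕ.* n ℕ.+ 1) ℕ.* x
      y = q ^ x
      w = q ^ e
      ε = (- 1#) ^ n
      S = Σ< n (λ r → (- 1#) ^ r * q ^ ((2 ℕ.* r ℕ.+ 1) ℕ.* x))
      next : ∀ n x → (2 ℕ.* suc n ℕ.+ 1) ℕ.* x ≡ (2 ℕ.* n ℕ.+ 1) ℕ.* x ℕ.+ (x ℕ.+ x)
      next = solve-∀

    -- For x ≥ 1 the remainder has exponent (2N + 3)x > N and is killed by the truncation.
    geometric-inverse : ∀ N → (∀ m → N < m → q ^ m ≈ 0#) → ∀ x → 1 ≤ x →
      (1# + q ^ x * q ^ x) * Σ< (suc N) (λ r → (- 1#) ^ r * q ^ ((2 ℕ.* r ℕ.+ 1) ℕ.* x)) ≈ q ^ x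
    geometric-inverse N q^≈0 x@(suc _) _ = begin
      u                          ≈⟨ +-identityʳ u ⟨
      u + 0#                     ≈⟨ +-congˡ (trans (*-congˡ (q^≈0 e N<e)) (zeroʳ _)) ⟨
      u + (- 1#) ^ suc N * q ^ e ≈⟨ geometric x (suc N) ⟩
      q ^ x                      ∎
      where
      u = (1# + q ^ x * q ^ x) * Σ< (suc N) (λ r → (- 1#) ^ r * q ^ ((2 ℕ.* r ℕ.+ 1) ℕ.* x))
      e = (2 ℕ.* suc N ℕ.+ 1) ℕ.* x
      N<e : N < e
      N<e = ℕ.≤-trans (ℕ.m≤m+n (suc N) _) (ℕ.≤-trans (ℕ.m≤m+n (2 ℕ.* suc N) 1) (ℕ.m≤m*n _ x))

    module _ (f : ℕ → Carrier) where

      -- The elementary symmetric polynomials of f 1, …, f N.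
      E : ℕ → ℕ → Carrier
      E zero    = one
      E (suc N) j = E N j + f (suc N) * shift (E N) j

      E-zero : ∀ N → E N 0 ≈ 1#
      E-zero zero    = refl
      E-zero (suc N) = trans (+-cong (E-zero N) (zeroʳ _)) (+-identityʳ 1#)

      E-one : ∀ N → E N 1 ≈ Σ< (suc N) (λ x → if 0 <ᵇ x then f x else 0#)
      E-one zero    = sym (+-identityˡ 0#)
      E-one (suc N) = +-cong (E-one N) (trans (*-congˡ (E-zero N)) (*-identityʳ _))

      -- The constraint 1 ≤ x < y is a Boolean test on a full square of indices, the same test as in
      -- `a-sum`, so that the two double sums can be compared entry by entry.
      pair : ℕ → ℕ → Carrier
      pair x y = if (0 <ᵇ x) ∧ (x <ᵇ y) then f x * f y else 0#

      pair-≥ : ∀ x y → y ≤ x → pair x y ≈ 0#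
      pair-≥ x y y≤x = reflexive (≡.cong (if_then f x * f y else 0#)
        (≡.trans (≡.cong ((0 <ᵇ x) ∧_) (≥⇒<ᵇ≡false y≤x)) (∧-zeroʳ (0 <ᵇ x))))

      pair-< : ∀ x y → x < y → pair x y ≈ f y * (if 0 <ᵇ x then f x else 0#)
      pair-< zero    y _   = sym (zeroʳ (f y))
      pair-< (suc x) y x<y = trans
        (reflexive (≡.cong (if_then f (suc x) * f y else 0#) (Equivalence.to T-≡ (ℕ.<⇒<ᵇ x<y))))
        (*-comm _ _)

      -- Enlarging the square by one adds the column y = N + 1, which carries `f (suc N) * E N 1`,
      -- and the row x = N + 1, on which x < y always fails.
      E-two : ∀ N → E N 2 ≈ Σ< (suc N) (λ x → Σ< (suc N) (pair x))
      E-two zero    = sym (Σ<-zero 1 (λ x _ → Σ<-zero 1 (λ y y<1 → pair-≥ x y (ℕ.≤-trans (ℕ.≤-pred y<1) z≤n))))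
      E-two (suc N) = begin
        E N 2 + f (suc N) * E N 1
          ≈⟨ +-cong (E-two N) (*-congˡ (E-one N)) ⟩
        Σ< (suc N) (λ x → Σ< (suc N) (pair x)) + f (suc N) * Σ< (suc N) (λ x → if 0 <ᵇ x then f x else 0#)
          ≈⟨ +-congˡ (Σ<-*ˡ (suc N) (f (suc N)) _) ⟨
        Σ< (suc N) (λ x → Σ< (suc N) (pair x)) + Σ< (suc N) (λ x → f (suc N) * (if 0 <ᵇ x then f x else 0#))
          ≈⟨ +-congˡ (Σ<-cong (suc N) (λ x x<1+N → sym (pair-< x (suc N) x<1+N))) ⟩
        Σ< (suc N) (λ x → Σ< (suc N) (pair x)) + Σ< (suc N) (λ x → pair x (suc N))
          ≈⟨ Σ<-+ (suc N) _ _ ⟨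
        Σ< (suc N) (λ x → Σ< (2 ℕ.+ N) (pair x))
          ≈⟨ +-identityʳ _ ⟨
        Σ< (suc N) (λ x → Σ< (2 ℕ.+ N) (pair x)) + 0#
          ≈⟨ +-congˡ (Σ<-zero (2 ℕ.+ N) (λ y y<2+N → pair-≥ (suc N) y (ℕ.≤-pred y<2+N))) ⟨
        Σ< (2 ℕ.+ N) (λ x → Σ< (2 ℕ.+ N) (pair x)) ∎

      module _ (f-inverse : ∀ x → 1 ≤ x → (1# + q ^ x * q ^ x) * f x ≈ q ^ x) where

        -- With f x = qˣ / (1 + q²ˣ), each factor splits as 1 + t qˣ + q²ˣ = (1 + q²ˣ)(1 + t f x);
        -- `A` collects the first parts and `E` the second.
        F-factor : ∀ N j → F N j ≈ A N * E N j
        F-factor zero    j = sym (*-identityˡ _)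
        F-factor (suc N) j = begin
          u * F N j + q ^ suc N * shift (F N) j
            ≈⟨ +-cong (*-congˡ (F-factor N j)) (*-cong (sym (f-inverse (suc N) (s≤s z≤n))) (shifted j)) ⟩
          u * (A N * E N j) + u * f (suc N) * (A N * shift (E N) j)
            ≈⟨ solve 5 (λ u v x y z → u :* (x :* y) :+ u :* v :* (x :* z) := u :* x :* (y :+ v :* z))
                 refl u (f (suc N)) (A N) (E N j) (shift (E N) j) ⟩
          u * A N * (E N j + f (suc N) * shift (E N) j) ∎
          where
          u = 1# + q ^ suc N * q ^ suc N
          shifted : ∀ j → shift (F N) j ≈ A N * shift (E N) j
          shifted zero    = sym (zeroʳ _)
          shifted (suc j) = F-factor N j

        -- The quotient of theta series.

        module _ (p : ℕ → ℕ → Carrier)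
                 (p-zero : ∀ j → p 0 j ≈ one j)
                 (p-neighbours : ∀ k j → neighbours (λ k → p k j) k ≈ shift (p k) j)
                 (N : ℕ) (q^≈0 : ∀ m → N < m → q ^ m ≈ 0#) where

          -- `Φ-C` read backwards replaces q^(T k) by `Φ N * C N k`; the sum is then the product
          -- `F`, which `F-factor` splits.
          theta-expansion : ∀ j → Σ< (suc N) (λ k → q ^ T k * p k j) ≈ Φ N * A N * E N j
          theta-expansion j = begin
            Σ< (suc N) (λ k → q ^ T k * p k j)
              ≈⟨ Σ<-cong (suc N) (λ k k<1+N → trans
                   (*-congʳ (sym (Φ-C N q^≈0 k (ℕ.≤-pred k<1+N)))) (*-assoc _ _ _)) ⟩
            Σ< (suc N) (λ k → Φ N * (C N k * p k j))
              ≈⟨ Σ<-*ˡ (suc N) (Φ N) _ ⟩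
            Φ N * Σ< (suc N) (λ k → C N k * p k j)
              ≈⟨ *-congˡ (sym (F-expansion p p-zero p-neighbours N (suc N) j ℕ.≤-refl)) ⟩
            Φ N * F N j
              ≈⟨ *-congˡ (F-factor N j) ⟩
            Φ N * (A N * E N j)
              ≈⟨ *-assoc _ _ _ ⟨
            Φ N * A N * E N j ∎

          -- The division is phrased as a product: `theta-expansion` at 0 evaluates the common
          -- factor `Φ N * A N`, because `E N 0` is 1.
          theta-quotient : ∀ j → Σ< (suc N) (λ k → q ^ T k * p k 0) * E N j ≈ Σ< (suc N) (λ k → q ^ T k * p k j)
          theta-quotient j = begin
            Σ< (suc N) (λ k → q ^ T k * p k 0) * E N j  ≈⟨ *-congʳ (theta-expansion 0) ⟩
            Φ N * A N * E N 0 * E N j                   ≈⟨ *-congʳ (trans (*-congˡ (E-zero N)) (*-identityʳ _)) ⟩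
            Φ N * A N * E N j                           ≈⟨ theta-expansion j ⟨
            Σ< (suc N) (λ k → q ^ T k * p k j)          ∎

-- Formal power series over the integers.

module Series where

  open ≡.≡-Reasoning

  infixl 7 _⊛_
  infixl 6 _⊕_

  _⊕_ : (ℕ → ℤ) → (ℕ → ℤ) → ℕ → ℤ
  (f ⊕ g) n = f n ℤ.+ g n

  -- The Cauchy product, by recursion on the degree from f = f 0 + q · (f ∘ suc). Inductions on the
  -- degree therefore keep `f` general.
  _⊛_ : (ℕ → ℤ) → (ℕ → ℤ) → ℕ → ℤ
  (f ⊛ g) zero    = f 0 ℤ.* g 0
  (f ⊛ g) (suc n) = f 0 ℤ.* g (suc n) ℤ.+ ((f ∘ suc) ⊛ g) n

  const : ℤ → ℕ → ℤ
  const z zero    = z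
  const z (suc n) = 0ℤ

  X : ℕ → ℤ
  X zero    = 0ℤ
  X (suc n) = const 1ℤ n

  ⊛-cong : ∀ {f f′ g g′} n → (∀ i → i ≤ n → f i ≡ f′ i) → (∀ i → i ≤ n → g i ≡ g′ i) →
           (f ⊛ g) n ≡ (f′ ⊛ g′) n
  ⊛-cong zero    f≗ g≗ = ≡.cong₂ ℤ._*_ (f≗ 0 z≤n) (g≗ 0 z≤n)
  ⊛-cong (suc n) f≗ g≗ = ≡.cong₂ ℤ._+_
    (≡.cong₂ ℤ._*_ (f≗ 0 z≤n) (g≗ (suc n) ℕ.≤-refl))
    (⊛-cong n (λ i i≤n → f≗ (suc i) (s≤s i≤n)) (λ i i≤n → g≗ i (ℕ.m≤n⇒m≤1+n i≤n)))

  ⊛-distribʳ : ∀ h f g n → ((f ⊕ g) ⊛ h) n ≡ (f ⊛ h) n ℤ.+ (g ⊛ h) n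
  ⊛-distribʳ h f g zero    = ℤ.*-distribʳ-+ (h 0) (f 0) (g 0)
  ⊛-distribʳ h f g (suc n) = ≡.trans
    (≡.cong (ℤ._+_ ((f 0 ℤ.+ g 0) ℤ.* h (suc n))) (⊛-distribʳ h (f ∘ suc) (g ∘ suc) n))
    (rearrange (f 0) (g 0) (h (suc n)) (((f ∘ suc) ⊛ h) n) (((g ∘ suc) ⊛ h) n))
    where
    rearrange : ∀ a b c d e → (a ℤ.+ b) ℤ.* c ℤ.+ (d ℤ.+ e) ≡ (a ℤ.* c ℤ.+ d) ℤ.+ (b ℤ.* c ℤ.+ e)
    rearrange = solveℤ-∀

  ⊛-scaleˡ : ∀ z f g n → ((λ i → z ℤ.* f i) ⊛ g) n ≡ z ℤ.* (f ⊛ g) n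
  ⊛-scaleˡ z f g zero    = ℤ.*-assoc z (f 0) (g 0)
  ⊛-scaleˡ z f g (suc n) = ≡.trans
    (≡.cong (ℤ._+_ (z ℤ.* f 0 ℤ.* g (suc n))) (⊛-scaleˡ z (f ∘ suc) g n))
    (rearrange z (f 0) (g (suc n)) (((f ∘ suc) ⊛ g) n))
    where
    rearrange : ∀ a b c d → a ℤ.* b ℤ.* c ℤ.+ a ℤ.* d ≡ a ℤ.* (b ℤ.* c ℤ.+ d)
    rearrange = solveℤ-∀

  -- The mirror image of the defining recursion, peeling `g` instead of `f`; commutativity compares
  -- the two.
  ⊛-suc : ∀ f g n → (f ⊛ g) (suc n) ≡ f (suc n) ℤ.* g 0 ℤ.+ (f ⊛ (g ∘ suc)) n
  ⊛-suc f g zero    = ℤ.+-comm (f 0 ℤ.* g 1) (f 1 ℤ.* g 0)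
  ⊛-suc f g (suc n) = ≡.trans
    (≡.cong (ℤ._+_ (f 0 ℤ.* g (suc (suc n)))) (⊛-suc (f ∘ suc) g n))
    (rearrange (f 0 ℤ.* g (suc (suc n))) (f (suc (suc n)) ℤ.* g 0) (((f ∘ suc) ⊛ (g ∘ suc)) n))
    where
    rearrange : ∀ a b c → a ℤ.+ (b ℤ.+ c) ≡ b ℤ.+ (a ℤ.+ c)
    rearrange = solveℤ-∀

  ⊛-comm : ∀ f g n → (f ⊛ g) n ≡ (g ⊛ f) n
  ⊛-comm f g zero    = ℤ.*-comm (f 0) (g 0)
  ⊛-comm f g (suc n) = ≡.trans
    (≡.cong₂ ℤ._+_ (ℤ.*-comm (f 0) (g (suc n))) (⊛-comm (f ∘ suc) g n))
    (≡.sym (⊛-suc g f n))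

  ⊛-assoc : ∀ f g h n → ((f ⊛ g) ⊛ h) n ≡ (f ⊛ (g ⊛ h)) n
  ⊛-assoc f g h zero    = ℤ.*-assoc (f 0) (g 0) (h 0)
  ⊛-assoc f g h (suc n) = begin
    -- By definition `(f ⊛ g) ∘ suc` is a multiple of `g ∘ suc` plus `(f ∘ suc) ⊛ g`, so
    -- distributivity and scaling expose the induction hypothesis.
    f 0 ℤ.* g 0 ℤ.* h (suc n) ℤ.+ (((λ i → f 0 ℤ.* g (suc i)) ⊕ (f ∘ suc) ⊛ g) ⊛ h) n
      ≡⟨ ≡.cong (ℤ._+_ (f 0 ℤ.* g 0 ℤ.* h (suc n))) (⊛-distribʳ h (λ i → f 0 ℤ.* g (suc i)) ((f ∘ suc) ⊛ g) n) ⟩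
    f 0 ℤ.* g 0 ℤ.* h (suc n) ℤ.+ (((λ i → f 0 ℤ.* g (suc i)) ⊛ h) n ℤ.+ (((f ∘ suc) ⊛ g) ⊛ h) n)
      ≡⟨ ≡.cong (ℤ._+_ (f 0 ℤ.* g 0 ℤ.* h (suc n))) (≡.cong₂ ℤ._+_ (⊛-scaleˡ (f 0) (g ∘ suc) h n) (⊛-assoc (f ∘ suc) g h n)) ⟩
    f 0 ℤ.* g 0 ℤ.* h (suc n) ℤ.+ (f 0 ℤ.* ((g ∘ suc) ⊛ h) n ℤ.+ ((f ∘ suc) ⊛ (g ⊛ h)) n)
      ≡⟨ rearrange (f 0) (g 0) (h (suc n)) (((g ∘ suc) ⊛ h) n) _ ⟩
    f 0 ℤ.* (g 0 ℤ.* h (suc n) ℤ.+ ((g ∘ suc) ⊛ h) n) ℤ.+ ((f ∘ suc) ⊛ (g ⊛ h)) n ∎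
    where
    rearrange : ∀ a b c d e → a ℤ.* b ℤ.* c ℤ.+ (a ℤ.* d ℤ.+ e) ≡ a ℤ.* (b ℤ.* c ℤ.+ d) ℤ.+ e
    rearrange = solveℤ-∀

  ⊛-zeroˡ : ∀ f g n → (∀ i → f i ≡ 0ℤ) → (f ⊛ g) n ≡ 0ℤ
  ⊛-zeroˡ f g zero    f≗0 = ≡.cong (ℤ._* g 0) (f≗0 0)
  ⊛-zeroˡ f g (suc n) f≗0 = ≡.cong₂ ℤ._+_ (≡.cong (ℤ._* g (suc n)) (f≗0 0)) (⊛-zeroˡ (f ∘ suc) g n (f≗0 ∘ suc))

  -- Constancy is a hypothesis on `f` rather than the form `const z`, so that it also covers the
  -- negated unit used in `[-1]^⊛`.
  ⊛-constˡ : ∀ f g n → (∀ i → f (suc i) ≡ 0ℤ) → (f ⊛ g) n ≡ f 0 ℤ.* g n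
  ⊛-constˡ f g zero    f≗ = ≡.refl
  ⊛-constˡ f g (suc n) f≗ = ≡.trans
    (≡.cong (ℤ._+_ (f 0 ℤ.* g (suc n))) (⊛-zeroˡ (f ∘ suc) g n f≗))
    (ℤ.+-identityʳ (f 0 ℤ.* g (suc n)))

  ⊛-identityˡ : ∀ g n → (const 1ℤ ⊛ g) n ≡ g n
  ⊛-identityˡ g n = ≡.trans (⊛-constˡ (const 1ℤ) g n (λ _ → ≡.refl)) (ℤ.*-identityˡ (g n))

  -- ℤ[[q]] modulo qᴹ: power series compared on their first M coefficients.
  truncated : ℕ → CommutativeRing 0ℓ 0ℓ
  truncated M = record
    { Carrier = ℕ → ℤ
    ; _≈_ = λ f g → ∀ n → n < M → f n ≡ g n
    ; _+_ = _⊕_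
    ; _*_ = _⊛_
    ; -_ = λ f n → ℤ.- f n
    ; 0# = λ _ → 0ℤ
    ; 1# = const 1ℤ
    ; isCommutativeRing = record
      { isRing = record
        { +-isAbelianGroup = record
          { isGroup = record
            { isMonoid = record
              { isSemigroup = record
                { isMagma = record
                  { isEquivalence = record
                    { refl  = λ _ _ → ≡.refl
                    ; sym   = λ f≈g n n<M → ≡.sym (f≈g n n<M)
                    ; trans = λ f≈g g≈h n n<M → ≡.trans (f≈g n n<M) (g≈h n n<M)
                    }
                  ; ∙-cong = λ f≈ g≈ n n<M → ≡.cong₂ ℤ._+_ (f≈ n n<M) (g≈ n n<M)
                  }
                ; assoc = λ f g h n _ → ℤ.+-assoc (f n) (g n) (h n)
                }
              ; identity = (λ f n _ → ℤ.+-identityˡ (f n)) , (λ f n _ → ℤ.+-identityʳ (f n))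
              }
            ; inverse = (λ f n _ → ℤ.+-inverseˡ (f n)) , (λ f n _ → ℤ.+-inverseʳ (f n))
            ; ⁻¹-cong = λ f≈ n n<M → ≡.cong ℤ.-_ (f≈ n n<M)
            }
          ; comm = λ f g n _ → ℤ.+-comm (f n) (g n)
          }
        ; *-cong = λ f≈ g≈ n n<M → ⊛-cong n
            (λ i i≤n → f≈ i (ℕ.≤-<-trans i≤n n<M)) (λ i i≤n → g≈ i (ℕ.≤-<-trans i≤n n<M))
        ; *-assoc = λ f g h n _ → ⊛-assoc f g h n
        ; *-identity = (λ g n _ → ⊛-identityˡ g n) , (λ g n _ → ≡.trans (⊛-comm g (const 1ℤ) n) (⊛-identityˡ g n))
        ; distrib = (λ f g h n _ → ≡.trans (⊛-comm f (g ⊕ h) n) (≡.trans (⊛-distribʳ f g h n)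
                       (≡.cong₂ ℤ._+_ (⊛-comm g f n) (⊛-comm h f n))))
                  , (λ h f g n _ → ⊛-distribʳ h f g n)
        }
      ; *-comm = λ f g n _ → ⊛-comm f g n
      }
    }

  X⊛-suc : ∀ g n → (X ⊛ g) (suc n) ≡ g n
  X⊛-suc g n = ≡.trans (ℤ.+-identityˡ _) (⊛-identityˡ g n)

  module _ (M : ℕ) where

    open CommutativeRing (truncated M) using (semiring; 1#; -_)
    open import Algebra.Properties.Semiring.Exp semiring using (_^_)

    X^-coefficient : ∀ e n → (X ^ e) n ≡ (if e ≡ᵇ n then 1ℤ else 0ℤ)
    X^-coefficient zero    zero    = ≡.refl
    X^-coefficient zero    (suc n) = ≡.refl
    X^-coefficient (suc e) zero    = ≡.refl
    X^-coefficient (suc e) (suc n) = ≡.trans (X⊛-suc (X ^ e) n) (X^-coefficient e n)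

    X^⊛-≥ : ∀ e g d → (X ^ e ⊛ g) (e ℕ.+ d) ≡ g d
    X^⊛-≥ zero    g d = ⊛-identityˡ g d
    X^⊛-≥ (suc e) g d = ≡.trans (⊛-assoc X (X ^ e) g (suc (e ℕ.+ d)))
      (≡.trans (X⊛-suc (X ^ e ⊛ g) (e ℕ.+ d)) (X^⊛-≥ e g d))

    X^⊛-< : ∀ e g n → n < e → (X ^ e ⊛ g) n ≡ 0ℤ
    X^⊛-< (suc e) g zero    _         = ⊛-assoc X (X ^ e) g 0
    X^⊛-< (suc e) g (suc n) (s≤s n<e) = ≡.trans (⊛-assoc X (X ^ e) g (suc n))
      (≡.trans (X⊛-suc (X ^ e ⊛ g) n) (X^⊛-< e g n n<e))

    [-1]^⊛ : ∀ r g n → ((- 1#) ^ r ⊛ g) n ≡ -1ℤ ℤ.^ r ℤ.* g n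
    [-1]^⊛ zero    g n = ≡.trans (⊛-identityˡ g n) (≡.sym (ℤ.*-identityˡ (g n)))
    [-1]^⊛ (suc r) g n = begin
      (((- 1#) ⊛ (- 1#) ^ r) ⊛ g) n     ≡⟨ ⊛-assoc (- 1#) ((- 1#) ^ r) g n ⟩
      ((- 1#) ⊛ ((- 1#) ^ r ⊛ g)) n     ≡⟨ ⊛-constˡ (- 1#) _ n (λ _ → ≡.refl) ⟩
      -1ℤ ℤ.* ((- 1#) ^ r ⊛ g) n        ≡⟨ ≡.cong (-1ℤ ℤ.*_) ([-1]^⊛ r g n) ⟩
      -1ℤ ℤ.* (-1ℤ ℤ.^ r ℤ.* g n)       ≡⟨ ℤ.*-assoc -1ℤ (-1ℤ ℤ.^ r) (g n) ⟨
      -1ℤ ℤ.* -1ℤ ℤ.^ r ℤ.* g n         ∎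

open import Data.Integer using (_*_; _-_; _^_)
open ≡ using (refl; sym; trans; cong; cong₂; subst)
open ≡.≡-Reasoning

-- Finite sums over lists.

∑-++ : ∀ xs ys → ∑ (xs ++ ys) ≡ ∑ xs ℤ.+ ∑ ys
∑-++ []       ys = sym (ℤ.+-identityˡ (∑ ys))
∑-++ (x ∷ xs) ys = trans (cong (ℤ._+_ x) (∑-++ xs ys)) (sym (ℤ.+-assoc x (∑ xs) (∑ ys)))

∑-cong : ∀ {A : Set} {f g : A → ℤ} → (∀ x → f x ≡ g x) → ∀ xs → ∑ (map f xs) ≡ ∑ (map g xs)
∑-cong f≗g xs = cong ∑ (map-cong f≗g xs)

∑-zero : ∀ {A : Set} {f : A → ℤ} → (∀ x → f x ≡ 0ℤ) → ∀ xs → ∑ (map f xs) ≡ 0ℤ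
∑-zero f≗0 []       = refl
∑-zero f≗0 (x ∷ xs) = cong₂ ℤ._+_ (f≗0 x) (∑-zero f≗0 xs)

∑-upTo-suc : ∀ f n → ∑ (map f (upTo (suc n))) ≡ ∑ (map f (upTo n)) ℤ.+ f n
∑-upTo-suc f n = begin
  ∑ (map f (upTo (suc n)))             ≡⟨ cong (∑ ∘ map f) (upTo-∷ʳ n) ⟨
  ∑ (map f (upTo n ++ n ∷ []))         ≡⟨ cong ∑ (map-++ f (upTo n) (n ∷ [])) ⟩
  ∑ (map f (upTo n) ++ f n ∷ [])       ≡⟨ ∑-++ (map f (upTo n)) (f n ∷ []) ⟩
  ∑ (map f (upTo n)) ℤ.+ (f n ℤ.+ 0ℤ)  ≡⟨ cong (ℤ._+_ (∑ (map f (upTo n)))) (ℤ.+-identityʳ (f n)) ⟩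
  ∑ (map f (upTo n)) ℤ.+ f n           ∎

∑-upTo-zero : ∀ f n → (∀ i → i < n → f i ≡ 0ℤ) → ∑ (map f (upTo n)) ≡ 0ℤ
∑-upTo-zero f zero    f≡0 = refl
∑-upTo-zero f (suc n) f≡0 = trans (∑-upTo-suc f n)
  (cong₂ ℤ._+_ (∑-upTo-zero f n (λ i i<n → f≡0 i (ℕ.m<n⇒m<1+n i<n))) (f≡0 n ℕ.≤-refl))

∑-upTo-single : ∀ f n i → i < n → (∀ j → j ≢ i → f j ≡ 0ℤ) → ∑ (map f (upTo n)) ≡ f i
∑-upTo-single f (suc n) i i<1+n f≡0 with i ℕ.≟ n
... | yes refl = begin
  ∑ (map f (upTo (suc n)))    ≡⟨ ∑-upTo-suc f n ⟩
  ∑ (map f (upTo n)) ℤ.+ f n  ≡⟨ cong (ℤ._+ f n) (∑-upTo-zero f n (λ j j<n → f≡0 j (ℕ.<⇒≢ j<n))) ⟩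
  0ℤ ℤ.+ f n                  ≡⟨ ℤ.+-identityˡ (f n) ⟩
  f n                         ∎
... | no i≢n = begin
  ∑ (map f (upTo (suc n)))    ≡⟨ ∑-upTo-suc f n ⟩
  ∑ (map f (upTo n)) ℤ.+ f n  ≡⟨ cong₂ ℤ._+_ (∑-upTo-single f n i (ℕ.≤∧≢⇒< (ℕ.≤-pred i<1+n) i≢n) f≡0) (f≡0 n (i≢n ∘ sym)) ⟩
  f i ℤ.+ 0ℤ                  ≡⟨ ℤ.+-identityʳ (f i) ⟩
  f i                         ∎

∑-filter : ∀ {A : Set} {P : A → Set} (P? : Decidable P) (s : A → ℤ) xs →
           ∑ (map s (filter P? xs)) ≡ ∑ (map (λ x → if does (P? x) then s x else 0ℤ) xs)
∑-filter P? s []       = refl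
∑-filter P? s (x ∷ xs) with does (P? x)
... | true  = cong (ℤ._+_ (s x)) (∑-filter P? s xs)
... | false = trans (∑-filter P? s xs) (sym (ℤ.+-identityˡ _))

∑-cartesianProduct : ∀ {A B : Set} (s : A × B → ℤ) xs ys →
  ∑ (map s (cartesianProduct xs ys)) ≡ ∑ (map (λ x → ∑ (map (λ y → s (x , y)) ys)) xs)
∑-cartesianProduct s []       ys = refl
∑-cartesianProduct s (x ∷ xs) ys = begin
  ∑ (map s (map (x ,_) ys ++ cartesianProduct xs ys))
    ≡⟨ cong ∑ (map-++ s (map (x ,_) ys) (cartesianProduct xs ys)) ⟩
  ∑ (map s (map (x ,_) ys) ++ map s (cartesianProduct xs ys))
    ≡⟨ ∑-++ (map s (map (x ,_) ys)) (map s (cartesianProduct xs ys)) ⟩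
  ∑ (map s (map (x ,_) ys)) ℤ.+ ∑ (map s (cartesianProduct xs ys))
    ≡⟨ cong₂ ℤ._+_ (cong ∑ (sym (map-∘ ys))) (∑-cartesianProduct s xs ys) ⟩
  ∑ (map (λ y → s (x , y)) ys) ℤ.+ ∑ (map (λ x → ∑ (map (λ y → s (x , y)) ys)) xs) ∎

∑-↭ : ∀ {xs ys} → xs ↭ ys → ∑ xs ≡ ∑ ys
∑-↭ xs↭ys = Permutation.foldr-commMonoid (≡.setoid ℤ) ℤ.+-0-isCommutativeMonoid (↭⇒↭ₛ xs↭ys)

-- The signed count as a sum over a common box.

box-mono : ∀ {m N q} → m ≤ N → q ∈ box m → q ∈ box N
box-mono {m} {N} m≤N q∈
  with x∈ , q∈ ← ∈-cartesianProduct⁻ (upTo (suc m)) _ q∈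
  with y∈ , q∈ ← ∈-cartesianProduct⁻ (upTo (suc m)) _ q∈
  with r∈ , s∈ ← ∈-cartesianProduct⁻ (upTo (suc m)) _ q∈
  = ∈-cartesianProduct⁺ (up x∈) (∈-cartesianProduct⁺ (up y∈) (∈-cartesianProduct⁺ (up r∈) (up s∈)))
  where
  up : ∀ {i} → i ∈ upTo (suc m) → i ∈ upTo (suc N)
  up i∈ = ∈-upTo⁺ (ℕ.≤-trans (∈-upTo⁻ i∈) (s≤s m≤N))

-- Puts all `a (+ m)` with m ≤ N over one index range, the range of the truncated series. Two
-- duplicate-free lists with the same members are permutations of each other.
quadruples-box : ∀ m N → m ≤ N → quadruples m ↭ filter (represents? m) (box N)
quadruples-box m N m≤N = ∼bag⇒↭ (unique∧set⇒bag (quadruples-unique m) unique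
  (λ {q} → mk⇔
    (λ q∈ → ∈-filter⁺ (represents? m) (box-mono m≤N (proj₁ (∈-filter⁻ (represents? m) {xs = box m} q∈)))
                      (Equivalence.to (∈-quadruples m q) q∈))
    (λ q∈ → Equivalence.from (∈-quadruples m q) (proj₂ (∈-filter⁻ (represents? m) {xs = box N} q∈)))))
  where
  I! = Unique.upTo⁺ (suc N)
  unique : Unique (filter (represents? m) (box N))
  unique = Unique.filter⁺ (represents? m)
    (Unique.cartesianProduct⁺ I! (Unique.cartesianProduct⁺ I! (Unique.cartesianProduct⁺ I! I!)))

-- At m = 0 the convention agrees with the sum, since no quadruple with positive part sizes
-- represents 0.
a-+ : ∀ m → a (+ m) ≡ ∑ (map sign (quadruples m))
a-+ zero    = refl
a-+ (suc m) = refl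

-- For m ≤ N this is the coefficient of qᵐ in the product of the truncated series of x and y, as
-- `f*f-coefficient` shows.
signedCount : ℕ → ℕ → ℕ → ℕ → ℤ
signedCount N m x y = ∑ (map (λ r₁ → ∑ (map (λ r₂ →
    if (2 ℕ.* r₁ ℕ.+ 1) ℕ.* x ℕ.+ (2 ℕ.* r₂ ℕ.+ 1) ℕ.* y ≡ᵇ m then -1ℤ ^ (r₁ ℕ.+ r₂) else 0ℤ)
  (upTo (suc N)))) (upTo (suc N)))

a-sum : ∀ m N → m ≤ N → a (+ m) ≡ ∑ (map (λ x → ∑ (map (λ y →
    if (0 <ᵇ x) ∧ (x <ᵇ y) then signedCount N m x y else 0ℤ)
  (upTo (suc N)))) (upTo (suc N)))
a-sum m N m≤N = begin
  a (+ m)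
    ≡⟨ a-+ m ⟩
  ∑ (map sign (quadruples m))
    ≡⟨ ∑-↭ (map⁺ sign (quadruples-box m N m≤N)) ⟩
  ∑ (map sign (filter (represents? m) (box N)))
    ≡⟨ ∑-filter (represents? m) sign (box N) ⟩
  ∑ (map s (box N))
    ≡⟨ ∑-cartesianProduct s I (cartesianProduct I (cartesianProduct I I)) ⟩
  ∑ (map (λ x → ∑ (map (λ q → s (x , q)) (cartesianProduct I (cartesianProduct I I)))) I)
    ≡⟨ ∑-cong (λ x → trans (∑-cartesianProduct (λ q → s (x , q)) I (cartesianProduct I I))
         (∑-cong (λ y → trans (∑-cartesianProduct (λ q → s (x , y , q)) I I) (inner x y)) I)) I ⟩
  ∑ (map (λ x → ∑ (map (λ y → if (0 <ᵇ x) ∧ (x <ᵇ y) then signedCount N m x y else 0ℤ) I)) I) ∎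
  where
  I = upTo (suc N)
  s : Quadruple → ℤ
  s q = if does (represents? m q) then sign q else 0ℤ
  inner : ∀ x y → ∑ (map (λ r₁ → ∑ (map (λ r₂ → s (x , y , r₁ , r₂)) I)) I) ≡
                  (if (0 <ᵇ x) ∧ (x <ᵇ y) then signedCount N m x y else 0ℤ)
  -- The decision for `Represents` computes to a conjunction of `<ᵇ` and `≡ᵇ` tests, and the first
  -- two do not involve r₁ and r₂.
  inner x y with 0 <ᵇ x | x <ᵇ y
  ... | true  | true  = refl
  ... | true  | false = ∑-zero (λ _ → ∑-zero (λ _ → refl) I) I
  ... | false | _     = ∑-zero (λ _ → ∑-zero (λ _ → refl) I) I

a-negative : ∀ n t → n < t → a (+ n - + t) ≡ 0ℤ
a-negative n t n<t
  rewrite ℤ.m-n≡m⊖n n t | ℤ.⊖-< n<t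
  with t ∸ n | ℕ.m<n⇒0<n∸m n<t
... | suc d | _ = refl

-- Monotonicity of the triangular numbers.

T-mono-< : ∀ {i j} → i < j → T i < T j
T-mono-< {i} {suc j} (s≤s i≤j) = subst (T i <_) (sym (T-suc j)) (ℕ.≤-<-trans (T-mono-≤ i≤j) (ℕ.m<m+n (T j) (s≤s z≤n)))
  where
  T-mono-≤ : ∀ {i j} → i ≤ j → T i ≤ T j
  T-mono-≤ {j = j} z≤n = z≤n
  T-mono-≤ {suc i} {suc j} (s≤s i≤j) =
    ≡.subst₂ _≤_ (sym (T-suc i)) (sym (T-suc j)) (ℕ.+-mono-≤ (T-mono-≤ i≤j) (s≤s i≤j))

T-injective : ∀ {i j} → T i ≡ T j → i ≡ j
T-injective {i} {j} Ti≡Tj with ℕ.<-cmp i j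
... | tri< i<j _ _ = contradiction Ti≡Tj (ℕ.<⇒≢ (T-mono-< i<j))
... | tri≈ _ i≡j _ = i≡j
... | tri> _ _ j<i = contradiction (sym Ti≡Tj) (ℕ.<⇒≢ (T-mono-< j<i))

-- Signs and the low coefficients of pₖ.

[-1]^n*[-1]^n≡1 : ∀ n → -1ℤ ^ n * -1ℤ ^ n ≡ 1ℤ
[-1]^n*[-1]^n≡1 zero    = refl
[-1]^n*[-1]^n≡1 (suc n) = trans (rearrange (-1ℤ ^ n)) ([-1]^n*[-1]^n≡1 n)
  where
  rearrange : ∀ x → -1ℤ * x * (-1ℤ * x) ≡ x * x
  rearrange = solveℤ-∀

-- `T (2 ℕ.+ k)` exceeds `T k` by the odd number 2k + 3.
[-1]^T-step : ∀ k → -1ℤ ^ T (2 ℕ.+ k) ≡ ℤ.- (-1ℤ ^ T k)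
[-1]^T-step k = begin
  -1ℤ ^ T (2 ℕ.+ k)                           ≡⟨ cong (-1ℤ ^_) (trans (T-suc (suc k)) (cong (ℕ._+ (2 ℕ.+ k)) (T-suc k))) ⟩
  -1ℤ ^ (T k ℕ.+ suc k ℕ.+ (2 ℕ.+ k))         ≡⟨ ℤ.^-distribˡ-+-* -1ℤ (T k ℕ.+ suc k) (2 ℕ.+ k) ⟩
  -1ℤ ^ (T k ℕ.+ suc k) * (-1ℤ * y)           ≡⟨ cong (_* (-1ℤ * y)) (ℤ.^-distribˡ-+-* -1ℤ (T k) (suc k)) ⟩
  -1ℤ ^ T k * y * (-1ℤ * y)                   ≡⟨ rearrange (-1ℤ ^ T k) y ⟩
  -1ℤ ^ T k * ℤ.- (y * y)                     ≡⟨ cong (λ z → -1ℤ ^ T k * ℤ.- z) ([-1]^n*[-1]^n≡1 (suc k)) ⟩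
  -1ℤ ^ T k * -1ℤ                             ≡⟨ negate (-1ℤ ^ T k) ⟩
  ℤ.- (-1ℤ ^ T k)                             ∎
  where
  y = -1ℤ ^ suc k
  rearrange : ∀ x y → x * y * (-1ℤ * y) ≡ x * ℤ.- (y * y)
  rearrange = solveℤ-∀
  negate : ∀ x → x * -1ℤ ≡ ℤ.- x
  negate = solveℤ-∀

-- p k j is the coefficient of tʲ in (zᵏ⁺¹ + z⁻ᵏ) / (z + 1), as a polynomial in t = z + z⁻¹.
p : ℕ → ℕ → ℤ
p-pred : ℕ → ℕ → ℤ
p zero          zero    = 1ℤ
p zero          (suc j) = 0ℤ
p (suc zero)    j       = p-pred zero j - p zero j
p (suc (suc k)) j       = p-pred (suc k) j - p k j
p-pred k zero    = 0ℤ
p-pred k (suc j) = p k j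

p-0 : ∀ k → p k 0 ≡ -1ℤ ^ T k
p-0 zero          = refl
p-0 (suc zero)    = refl
p-0 (suc (suc k)) = trans (ℤ.+-identityˡ (ℤ.- p k 0)) (trans (cong ℤ.-_ (p-0 k)) (sym ([-1]^T-step k)))

-- Two steps of the recurrence flip the sign and, through the constant coefficient `p-0`, raise the
-- absolute value by one.
p-1 : ∀ k → p (suc k) 1 ≡ -1ℤ ^ T k * + ⌈ suc k /2⌉
p-1 zero          = refl
p-1 (suc zero)    = refl
p-1 (suc (suc k)) = begin
  p (2 ℕ.+ k) 0 - p (suc k) 1       ≡⟨ cong₂ _-_ (p-0 (2 ℕ.+ k)) (p-1 k) ⟩
  -1ℤ ^ T (2 ℕ.+ k) - s * + c       ≡⟨ cong (_- s * + c) ([-1]^T-step k) ⟩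
  ℤ.- s - s * + c                   ≡⟨ rearrange s (+ c) ⟩
  ℤ.- s * (1ℤ ℤ.+ + c)              ≡⟨ cong (_* + suc c) ([-1]^T-step k) ⟨
  -1ℤ ^ T (2 ℕ.+ k) * + suc c       ∎
  where
  s = -1ℤ ^ T k
  c = ⌈ suc k /2⌉
  rearrange : ∀ x y → ℤ.- x - x * y ≡ ℤ.- x * (1ℤ ℤ.+ y)
  rearrange = solveℤ-∀

-- Two steps flip the sign and add the absolute value c + 1 supplied by `p-1`. The values 1, 2, 3,
-- ... accumulate to the triangular number of the claim.
p-2 : ∀ k → p (2 ℕ.+ k) 2 ≡ -1ℤ ^ T k * + T ⌈ suc k /2⌉
p-2 zero          = refl
p-2 (suc zero)    = refl
p-2 (suc (suc k)) = begin
  p (3 ℕ.+ k) 1 - p (2 ℕ.+ k) 2                 ≡⟨ cong₂ _-_ (p-1 (2 ℕ.+ k)) (p-2 k) ⟩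
  -1ℤ ^ T (2 ℕ.+ k) * + suc c - s * + T c       ≡⟨ cong (λ z → z * + suc c - s * + T c) ([-1]^T-step k) ⟩
  ℤ.- s * + suc c - s * + T c                   ≡⟨ rearrange s (+ suc c) (+ T c) ⟩
  ℤ.- s * (+ T c ℤ.+ + suc c)                   ≡⟨ cong (λ z → ℤ.- s * + z) (T-suc c) ⟨
  ℤ.- s * + T (suc c)                           ≡⟨ cong (_* + T (suc c)) ([-1]^T-step k) ⟨
  -1ℤ ^ T (2 ℕ.+ k) * + T (suc c)               ∎
  where
  s = -1ℤ ^ T k
  c = ⌈ suc k /2⌉
  rearrange : ∀ x y z → ℤ.- x * y - x * z ≡ ℤ.- x * (z ℤ.+ y)
  rearrange = solveℤ-∀

open Series

-- Specialisation to integer power series modulo q^(N+1).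

module _ (N : ℕ) where

  private
    module R = CommutativeRing (truncated (suc N))
  open FiniteTripleProduct (truncated (suc N)) 
    using (Σ<; Σ<-*ˡ; Σ<-*ʳ; one; shift; neighbours; E; E-two; pair; geometric-inverse; theta-quotient; ^-homo-*)
    renaming (_^_ to _^ᴿ_)

  Σ<-coefficient : ∀ n F m → Σ< n F m ≡ ∑ (map (λ i → F i m) (upTo n))
  Σ<-coefficient zero    F m = refl
  Σ<-coefficient (suc n) F m = trans (cong (ℤ._+ F n m) (Σ<-coefficient n F m)) (sym (∑-upTo-suc (λ i → F i m) n))

  X^-vanishes : ∀ m → N < m → X ^ᴿ m R.≈ R.0#
  X^-vanishes m N<m n n<1+N = trans (X^-coefficient (suc N) m n)
    (cong (if_then 1ℤ else 0ℤ) (dec-false (m ℕ.≟ n) (ℕ.>⇒≢ (ℕ.<-≤-trans n<1+N N<m))))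

  term : ℕ → ℕ → ℕ → ℤ
  term x r = (R.- R.1#) ^ᴿ r R.* X ^ᴿ ((2 ℕ.* r ℕ.+ 1) ℕ.* x)

  f : ℕ → ℕ → ℤ
  f x = Σ< (suc N) (term x)

  f-inverse : ∀ x → 1 ≤ x → (R.1# R.+ X ^ᴿ x R.* X ^ᴿ x) R.* f x R.≈ X ^ᴿ x
  f-inverse = geometric-inverse X N X^-vanishes

  term-coefficient : ∀ x y r₁ r₂ m → m ≤ N → (term x r₁ R.* term y r₂) m ≡
    (if (2 ℕ.* r₁ ℕ.+ 1) ℕ.* x ℕ.+ (2 ℕ.* r₂ ℕ.+ 1) ℕ.* y ≡ᵇ m then -1ℤ ^ (r₁ ℕ.+ r₂) else 0ℤ)
  term-coefficient x y r₁ r₂ m m≤N = begin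
    (ε₁ R.* X ^ᴿ e₁ R.* (ε₂ R.* X ^ᴿ e₂)) m
      ≡⟨ collect m (s≤s m≤N) ⟩
    (ε₁ R.* (ε₂ R.* X ^ᴿ (e₁ ℕ.+ e₂))) m
      ≡⟨ [-1]^⊛ (suc N) r₁ (ε₂ R.* X ^ᴿ (e₁ ℕ.+ e₂)) m ⟩
    -1ℤ ^ r₁ * (ε₂ R.* X ^ᴿ (e₁ ℕ.+ e₂)) m
      ≡⟨ cong (-1ℤ ^ r₁ *_) ([-1]^⊛ (suc N) r₂ (X ^ᴿ (e₁ ℕ.+ e₂)) m) ⟩
    -1ℤ ^ r₁ * (-1ℤ ^ r₂ * (X ^ᴿ (e₁ ℕ.+ e₂)) m)
      ≡⟨ ℤ.*-assoc (-1ℤ ^ r₁) (-1ℤ ^ r₂) _ ⟨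
    -1ℤ ^ r₁ * -1ℤ ^ r₂ * (X ^ᴿ (e₁ ℕ.+ e₂)) m
      ≡⟨ cong₂ _*_ (sym (ℤ.^-distribˡ-+-* -1ℤ r₁ r₂)) (X^-coefficient (suc N) (e₁ ℕ.+ e₂) m) ⟩
    -1ℤ ^ (r₁ ℕ.+ r₂) * (if e₁ ℕ.+ e₂ ≡ᵇ m then 1ℤ else 0ℤ)
      ≡⟨ indicator (e₁ ℕ.+ e₂ ≡ᵇ m) (-1ℤ ^ (r₁ ℕ.+ r₂)) ⟩
    (if e₁ ℕ.+ e₂ ≡ᵇ m then -1ℤ ^ (r₁ ℕ.+ r₂) else 0ℤ) ∎
    where
    e₁ = (2 ℕ.* r₁ ℕ.+ 1) ℕ.* x
    e₂ = (2 ℕ.* r₂ ℕ.+ 1) ℕ.* y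
    ε₁ = (R.- R.1#) ^ᴿ r₁
    ε₂ = (R.- R.1#) ^ᴿ r₂
    indicator : ∀ b z → z * (if b then 1ℤ else 0ℤ) ≡ (if b then z else 0ℤ)
    indicator true  z = ℤ.*-identityʳ z
    indicator false z = ℤ.*-zeroʳ z
    collect : ε₁ R.* X ^ᴿ e₁ R.* (ε₂ R.* X ^ᴿ e₂) R.≈ ε₁ R.* (ε₂ R.* X ^ᴿ (e₁ ℕ.+ e₂))
    collect = R.trans (R.*-assoc ε₁ (X ^ᴿ e₁) (ε₂ R.* X ^ᴿ e₂)) (R.*-congˡ {x = ε₁}
      (R.trans (x∙yz≈y∙xz (X ^ᴿ e₁) ε₂ (X ^ᴿ e₂)) (R.*-congˡ {x = ε₂} (R.sym (^-homo-* X e₁ e₂)))))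
      where open import Algebra.Properties.CommutativeSemigroup R.*-commutativeSemigroup using (x∙yz≈y∙xz)

  f*f-coefficient : ∀ x y m → m ≤ N → (f x R.* f y) m ≡ signedCount N m x y
  f*f-coefficient x y m m≤N = begin
    (Σ< (suc N) (term x) R.* f y) m
      ≡⟨ Σ<-*ʳ (suc N) (term x) (f y) m (s≤s m≤N) ⟨
    Σ< (suc N) (λ r₁ → term x r₁ R.* f y) m
      ≡⟨ Σ<-coefficient (suc N) (λ r₁ → term x r₁ R.* f y) m ⟩
    ∑ (map (λ r₁ → (term x r₁ R.* f y) m) (upTo (suc N)))
      ≡⟨ ∑-cong (λ r₁ → begin
           (term x r₁ R.* f y) m
             ≡⟨ Σ<-*ˡ (suc N) (term x r₁) (term y) m (s≤s m≤N) ⟨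
           Σ< (suc N) (λ r₂ → term x r₁ R.* term y r₂) m
             ≡⟨ Σ<-coefficient (suc N) (λ r₂ → term x r₁ R.* term y r₂) m ⟩
           ∑ (map (λ r₂ → (term x r₁ R.* term y r₂) m) (upTo (suc N)))
             ≡⟨ ∑-cong (λ r₂ → term-coefficient x y r₁ r₂ m m≤N) (upTo (suc N)) ⟩
           _ ∎) (upTo (suc N)) ⟩
    signedCount N m x y ∎

  -- The link between `a` and the series: `E-two` and `a-sum` are double sums with the same test on
  -- x and y, and `f*f-coefficient` matches their entries.
  a-coefficient : ∀ m → m ≤ N → E X f N 2 m ≡ a (+ m)
  a-coefficient m m≤N = begin
    E X f N 2 m
      ≡⟨ E-two X f N m (s≤s m≤N) ⟩
    Σ< (suc N) (λ x → Σ< (suc N) (pair X f x)) m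
      ≡⟨ Σ<-coefficient (suc N) (λ x → Σ< (suc N) (pair X f x)) m ⟩
    ∑ (map (λ x → Σ< (suc N) (pair X f x) m) (upTo (suc N)))
      ≡⟨ ∑-cong (λ x → trans (Σ<-coefficient (suc N) (pair X f x) m)
           (∑-cong (λ y → pair-coefficient x y) (upTo (suc N)))) (upTo (suc N)) ⟩
    _ ≡⟨ a-sum m N m≤N ⟨
    a (+ m) ∎
    where
    pair-coefficient : ∀ x y → pair X f x y m ≡ (if (0 <ᵇ x) ∧ (x <ᵇ y) then signedCount N m x y else 0ℤ)
    pair-coefficient x y with (0 <ᵇ x) ∧ (x <ᵇ y)
    ... | true  = f*f-coefficient x y m m≤N
    ... | false = refl

  i+[j-i]≡j : ∀ i j → i ℤ.+ (j - i) ≡ j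
  i+[j-i]≡j = solveℤ-∀

  pᴿ : ℕ → ℕ → ℕ → ℤ
  pᴿ k j = const (p k j)

  pᴿ-zero : ∀ j → pᴿ 0 j R.≈ one j
  pᴿ-zero zero    n       _ = refl
  pᴿ-zero (suc j) zero    _ = refl
  pᴿ-zero (suc j) (suc n) _ = refl

  -- The recurrence t pₖ = pₖ₋₁ + pₖ₊₁, coefficient by coefficient. At k = 0 the convention p₋₁ = p₀
  -- agrees with (zᵏ⁺¹ + z⁻ᵏ) / (z + 1), which is 1 for both indices.
  pᴿ-neighbours : ∀ k j → neighbours (λ k → pᴿ k j) k R.≈ shift (pᴿ k) j
  pᴿ-neighbours zero    zero    zero    _ = refl
  pᴿ-neighbours zero    (suc j) zero    _ = i+[j-i]≡j (p 0 (suc j)) (p 0 j)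
  pᴿ-neighbours (suc k) zero    zero    _ = i+[j-i]≡j (p k 0) 0ℤ
  pᴿ-neighbours (suc k) (suc j) zero    _ = i+[j-i]≡j (p k (suc j)) (p (suc k) j)
  pᴿ-neighbours zero    zero    (suc n) _ = refl
  pᴿ-neighbours zero    (suc j) (suc n) _ = refl
  pᴿ-neighbours (suc k) zero    (suc n) _ = refl
  pᴿ-neighbours (suc k) (suc j) (suc n) _ = refl

  -- The coefficient of t² and qⁿ in `theta-quotient`. On the left `p-0` supplies the signs and
  -- multiplication by q^(T r) shifts the argument of `a`; on the right q^(T k) selects T k = n.
  theta-coefficient : ∀ n → n ≤ N →
    ∑ (map (λ r → (-1ℤ ^ T r) * a (+ n - + T r)) (upTo (suc N))) ≡
    ∑ (map (λ k → p k 2 * (if T k ≡ᵇ n then 1ℤ else 0ℤ)) (upTo (suc N)))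
  theta-coefficient n n≤N = begin
    ∑ (map (λ r → (-1ℤ ^ T r) * a (+ n - + T r)) (upTo (suc N)))
      ≡⟨ ∑-cong left (upTo (suc N)) ⟩
    ∑ (map (λ k → (X ^ᴿ T k R.* pᴿ k 0 R.* A) n) (upTo (suc N)))
      ≡⟨ Σ<-coefficient (suc N) (λ k → X ^ᴿ T k R.* pᴿ k 0 R.* A) n ⟨
    Σ< (suc N) (λ k → X ^ᴿ T k R.* pᴿ k 0 R.* A) n
      ≡⟨ Σ<-*ʳ (suc N) (λ k → X ^ᴿ T k R.* pᴿ k 0) A n (s≤s n≤N) ⟩
    (Σ< (suc N) (λ k → X ^ᴿ T k R.* pᴿ k 0) R.* A) n
      ≡⟨ theta-quotient X f f-inverse pᴿ pᴿ-zero pᴿ-neighbours N X^-vanishes 2 n (s≤s n≤N) ⟩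
    Σ< (suc N) (λ k → X ^ᴿ T k R.* pᴿ k 2) n
      ≡⟨ Σ<-coefficient (suc N) (λ k → X ^ᴿ T k R.* pᴿ k 2) n ⟩
    ∑ (map (λ k → (X ^ᴿ T k R.* pᴿ k 2) n) (upTo (suc N)))
      ≡⟨ ∑-cong right (upTo (suc N)) ⟩
    ∑ (map (λ k → p k 2 * (if T k ≡ᵇ n then 1ℤ else 0ℤ)) (upTo (suc N))) ∎
    where
    A = E X f N 2

    scale : ∀ g z → (g R.* const z) n ≡ z * g n
    scale g z = trans (⊛-comm g (const z) n) (⊛-constˡ (const z) g n (λ _ → refl))

    shifted : ∀ t → (X ^ᴿ t R.* A) n ≡ a (+ n - + t)
    shifted t with t ℕ.≤? n
    ... | yes t≤n = begin
      (X ^ᴿ t R.* A) n                    ≡⟨ cong (X ^ᴿ t R.* A) (ℕ.m+[n∸m]≡n t≤n) ⟨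
      (X ^ᴿ t R.* A) (t ℕ.+ (n ∸ t))      ≡⟨ X^⊛-≥ (suc N) t A (n ∸ t) ⟩
      A (n ∸ t)                           ≡⟨ a-coefficient (n ∸ t) (ℕ.≤-trans (ℕ.m∸n≤m n t) n≤N) ⟩
      a (+ (n ∸ t))                       ≡⟨ cong a (trans (ℤ.m-n≡m⊖n n t) (ℤ.⊖-≥ t≤n)) ⟨
      a (+ n - + t)                       ∎
    -- Beyond n the shifted series has coefficient 0, which agrees with the convention for `a` at
    -- negative arguments.
    ... | no t≰n = trans (X^⊛-< (suc N) t A n (ℕ.≰⇒> t≰n)) (sym (a-negative n t (ℕ.≰⇒> t≰n)))

    left : ∀ k → (-1ℤ ^ T k) * a (+ n - + T k) ≡ (X ^ᴿ T k R.* pᴿ k 0 R.* A) n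
    left k = sym (begin
      (X ^ᴿ T k R.* pᴿ k 0 R.* A) n     ≡⟨ xy∙z≈xz∙y (X ^ᴿ T k) (pᴿ k 0) A n (s≤s n≤N) ⟩
      (X ^ᴿ T k R.* A R.* pᴿ k 0) n     ≡⟨ scale (X ^ᴿ T k R.* A) (p k 0) ⟩
      p k 0 * (X ^ᴿ T k R.* A) n        ≡⟨ cong₂ _*_ (p-0 k) (shifted (T k)) ⟩
      -1ℤ ^ T k * a (+ n - + T k)       ∎)
      where open import Algebra.Properties.CommutativeSemigroup R.*-commutativeSemigroup using (xy∙z≈xz∙y)

    right : ∀ k → (X ^ᴿ T k R.* pᴿ k 2) n ≡ p k 2 * (if T k ≡ᵇ n then 1ℤ else 0ℤ)
    right k = trans (scale (X ^ᴿ T k) (p k 2)) (cong (p k 2 *_) (X^-coefficient (suc N) (T k) n))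

-- From truncated identities to the infinite sum.

HasSum-intro : ∀ n s → (∀ M → n < M → ∑ (map (λ k → p k 2 * (if T k ≡ᵇ n then 1ℤ else 0ℤ)) (upTo M)) ≡ s) →
               HasSum (λ r → (-1ℤ ^ T r) * a (+ n - + T r)) s
-- The truncation order follows the partial sum: the one with M = N + 1 > n terms is computed modulo
-- q^(N+1).
HasSum-intro n s h = suc n , λ { (suc N) n<M@(s≤s n≤N) → trans (theta-coefficient N n n≤N) (h (suc N) n<M) }

corollary1p5 : (n : ℕ) → 1 ≤ n →
    ((k : ℕ) → 1 ≤ k → n ≡ T (k ℕ.+ 1) →
    HasSum (λ r → (-1ℤ ^ T r) * a (+ n - + T r)) ((-1ℤ ^ T (k ∸ 1)) * + T ⌈ k /2⌉))
    × (¬ (∃[ k ] (1 ≤ k × n ≡ T (k ℕ.+ 1))) →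
    HasSum (λ r → (-1ℤ ^ T r) * a (+ n - + T r)) 0ℤ)
corollary1p5 n 1≤n = triangular , other
  where
  weight : ℕ → ℤ
  weight k = p k 2 * (if T k ≡ᵇ n then 1ℤ else 0ℤ)

  weight-≢ : ∀ k → T k ≢ n → weight k ≡ 0ℤ
  weight-≢ k Tk≢n = trans (cong (λ b → p k 2 * (if b then 1ℤ else 0ℤ)) (dec-false (T k ℕ.≟ n) Tk≢n)) (ℤ.*-zeroʳ (p k 2))

  weight-≡ : ∀ k → T k ≡ n → weight k ≡ p k 2
  weight-≡ k Tk≡n = trans (cong (λ b → p k 2 * (if b then 1ℤ else 0ℤ)) (dec-true (T k ℕ.≟ n) Tk≡n)) (ℤ.*-identityʳ (p k 2))

  triangular : (k : ℕ) → 1 ≤ k → n ≡ T (k ℕ.+ 1) →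
    HasSum (λ r → (-1ℤ ^ T r) * a (+ n - + T r)) ((-1ℤ ^ T (k ∸ 1)) * + T ⌈ k /2⌉)
  triangular (suc k) _ n≡T = HasSum-intro n _ λ M n<M → begin
    -- The matched `k` is one less than that of the claim, so n = T (2 + k). Injectivity of `T`
    -- leaves this single weight, and 2 + k ≤ T (2 + k) = n < M puts it in range.
    ∑ (map weight (upTo M))  ≡⟨ ∑-upTo-single weight M (2 ℕ.+ k)
                                  (ℕ.≤-<-trans (subst (2 ℕ.+ k ≤_) T≡n (n≤T[n] (2 ℕ.+ k))) n<M)
                                  (λ j j≢ → weight-≢ j (λ Tj≡n → j≢ (T-injective (trans Tj≡n (sym T≡n))))) ⟩
    weight (2 ℕ.+ k)         ≡⟨ weight-≡ (2 ℕ.+ k) T≡n ⟩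
    p (2 ℕ.+ k) 2            ≡⟨ p-2 k ⟩
    _                        ∎
    where
    T≡n : T (2 ℕ.+ k) ≡ n
    T≡n = sym (trans n≡T (cong T (ℕ.+-comm (suc k) 1)))

  other : ¬ (∃[ k ] (1 ≤ k × n ≡ T (k ℕ.+ 1))) → HasSum (λ r → (-1ℤ ^ T r) * a (+ n - + T r)) 0ℤ
  other ¬tri = HasSum-intro n 0ℤ λ M _ → ∑-zero zero-weight (upTo M)
    where
    zero-weight : ∀ k → weight k ≡ 0ℤ
    -- The polynomials p₀ and p₁ have degree below 2, so the triangular numbers 0 and 1 contribute
    -- nothing; this covers n = 1.
    zero-weight zero          = refl
    zero-weight (suc zero)    = refl
    zero-weight (suc (suc k)) = weight-≢ (2 ℕ.+ k) λ T≡n →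
      ¬tri (suc k , s≤s z≤n , trans (sym T≡n) (cong T (sym (ℕ.+-comm (suc k) 1))))
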